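{- Let $G$ be a triangulated graph of order $n\ge 1$, with chromatic number $\chi(G)$ and maximum degree $\Delta(G)$. Then: (i) $\mathcal{A}(G)\ge \mathcal{A}\big(K_{\chi(G)}\cup (n-\chi(G))K_1\big)$, with equality if and only if $G\simeq K_{\chi(G)}\cup (n-\chi(G))K_1$; (ii) $\mathcal{A}(G)\ge \mathcal{A}\big(K_{1,\Delta(G)}\cup (n-\Delta(G)-1)K_1\big)$, with equality if and only if $G\simeq K_{1,\Delta(G)}\cup (n-\Delta(G)-1)K_1$; (iii) consequently $\mathcal{A}(G)\ge \mathcal{A}(E_n)$, with equality if and only if $G\simeq E_n$.
   Context: All graphs are finite, simple and undirected. A coloring of a graph $G$ assigns colors to its vertices so that adjacent vertices receive different colors; two colorings are equivalent if they induce the same partition of the vertex set into color classes. For $k\ge 1$, $S(G,k)$ denotes the number of non-equivalent colorings of $G$ using exactly $k$ colors (i.e. the number of partitions of $V(G)$ into exactly $k$ nonempty stable sets). Set $\mathcal{B}(G)=\sum_{k\ge1}S(G,k)$, $\mathcal{T}(G)=\sum_{k\ge1}kS(G,k)$ and $\mathcal{A}(G)=\mathcal{T}(G)/\mathcal{B}(G)$, the average number of colors in the non-equivalent colorings of $G$. A vertex is simplicial if its neighbors induce a clique; a graph is triangulated if each of its induced subgraphs contains a simplicial vertex. $K_n$ is the complete graph, $E_n$ the empty (edgeless) graph of order $n$, $K_{a,b}$ the complete bipartite graph with parts of sizes $a,b$ (so $K_{1,0}=K_1$), $G_1\cup G_2$ the disjoint union, and $pK_1$ denotes $p$ isolated vertices.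 -}

module Defs where

open import Data.Nat using (ℕ; zero; suc; _+_; _*_; _∸_; _≤_; _<_; _≡ᵇ_; _<ᵇ_; _≤ᵇ_)
open import Data.Fin using (Fin; toℕ)
open import Data.Fin as F using ()
open import Data.Bool using (Bool; true; false; _∧_; _∨_; not; if_then_else_)
open import Data.Bool.Properties using (∧-comm; ∨-comm)
open import Data.List using (List; []; _∷_; map; concatMap; allFin)
open import Data.Bool.ListAction using (all; any)
open import Data.Product using (Σ; ∃; _×_; _,_)
open import Function.Bundles using (_↔_; Inverse)
open import Relation.Binary.PropositionalEquality using (_≡_; _≢_; refl; cong; cong₂)

record Graph (n : ℕ) : Set where
  field
    adj    : Fin n → Fin n → Bool
    sym    : ∀ i j → adj i j ≡ adj j i
    irrefl : ∀ i → adj i i ≡ false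
open Graph public

_==_ : ∀ {n} → Fin n → Fin n → Bool
i == j = toℕ i ≡ᵇ toℕ j

≡ᵇ-sym : ∀ a b → (a ≡ᵇ b) ≡ (b ≡ᵇ a)
≡ᵇ-sym zero zero = refl
≡ᵇ-sym zero (suc b) = refl
≡ᵇ-sym (suc a) zero = refl
≡ᵇ-sym (suc a) (suc b) = ≡ᵇ-sym a b

≡ᵇ-refl : ∀ a → (a ≡ᵇ a) ≡ true
≡ᵇ-refl zero = refl
≡ᵇ-refl (suc a) = ≡ᵇ-refl a

countTrue : List Bool → ℕ
countTrue [] = 0
countTrue (b ∷ bs) = (if b then 1 else 0) + countTrue bs

sumFrom1 : ℕ → (ℕ → ℕ) → ℕ
sumFrom1 zero f = 0
sumFrom1 (suc m) f = sumFrom1 m f + f (suc m)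

cons : ∀ {n k} → Fin k → (Fin n → Fin k) → Fin (suc n) → Fin k
cons a f F.zero = a
cons a f (F.suc i) = f i

allFuns : (n k : ℕ) → List (Fin n → Fin k)
allFuns zero k = (λ ()) ∷ []
allFuns (suc n) k = concatMap (λ a → map (cons a) (allFuns n k)) (allFin k)

Proper : ∀ {n k} → Graph n → (Fin n → Fin k) → Set
Proper G c = ∀ i j → adj G i j ≡ true → c i ≢ c j

properᵇ : ∀ {n k} → Graph n → (Fin n → Fin k) → Bool
properᵇ {n} G c = all (λ i → all (λ j → not (adj G i j) ∨ not (c i == c j)) (allFin n)) (allFin n)

surjᵇ : ∀ {n k} → (Fin n → Fin k) → Bool
surjᵇ {n} {k} c = all (λ a → any (λ i → c i == a) (allFin n)) (allFin k)

-- canonical representative of an equivalence class of colorings: the color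
-- classes are numbered in increasing order of their smallest vertex, i.e.
-- every color smaller than c i already occurs at some vertex j < i.
canonicalᵇ : ∀ {n k} → (Fin n → Fin k) → Bool
canonicalᵇ {n} {k} c =
  all (λ i → all (λ a → not (toℕ a <ᵇ toℕ (c i))
                         ∨ any (λ j → (toℕ j <ᵇ toℕ i) ∧ (c j == a)) (allFin n))
                 (allFin k))
      (allFin n)

-- S(G,k): number of partitions of V(G) into exactly k nonempty stable sets,
-- counted as canonical proper colorings using all k colors.
S : ∀ {n} → Graph n → ℕ → ℕ
S {n} G k = countTrue (map (λ c → properᵇ G c ∧ (surjᵇ c ∧ canonicalᵇ c)) (allFuns n k))

-- B(G) = Σ_{k≥1} S(G,k)  (S(G,k) = 0 for k > n, so the sum stops at n)
𝓑 : ∀ {n} → Graph n → ℕ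
𝓑 {n} G = sumFrom1 n (S G)

𝓣 : ∀ {n} → Graph n → ℕ
𝓣 {n} G = sumFrom1 n (λ k → k * S G k)

-- comparison of averages A(G) = T(G)/B(G), A(H) = T(H)/B(H) (positive
-- denominators), written with cross-multiplication:
-- A(G) ≥ A(H)   iff   T(H) B(G) ≤ T(G) B(H)
_A≥_ : ∀ {n m} → Graph n → Graph m → Set
G A≥ H = 𝓣 H * 𝓑 G ≤ 𝓣 G * 𝓑 H

_A≡_ : ∀ {n m} → Graph n → Graph m → Set
G A≡ H = 𝓣 G * 𝓑 H ≡ 𝓣 H * 𝓑 G

IsChromaticNumber : ∀ {n} → Graph n → ℕ → Set
IsChromaticNumber {n} G χ =
  (Σ (Fin n → Fin χ) λ c → Proper G c) ×
  (∀ k (c : Fin n → Fin k) → Proper G c → χ ≤ k)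

degree : ∀ {n} → Graph n → Fin n → ℕ
degree {n} G v = countTrue (map (adj G v) (allFin n))

IsMaxDegree : ∀ {n} → Graph n → ℕ → Set
IsMaxDegree {n} G Δ = (Σ (Fin n) λ v → degree G v ≡ Δ) × (∀ v → degree G v ≤ Δ)

SimplicialIn : ∀ {n} → Graph n → (Fin n → Bool) → Fin n → Set
SimplicialIn G U v =
  ∀ u w → U u ≡ true → U w ≡ true → adj G v u ≡ true → adj G v w ≡ true →
  u ≢ w → adj G u w ≡ true

Triangulated : ∀ {n} → Graph n → Set
Triangulated {n} G =
  ∀ (U : Fin n → Bool) → (Σ (Fin n) λ v → U v ≡ true) →
  Σ (Fin n) λ v → (U v ≡ true) × SimplicialIn G U v

_≅_ : ∀ {n} → Graph n → Graph n → Set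
_≅_ {n} G H = Σ (Fin n ↔ Fin n) λ f →
  ∀ i j → adj H (Inverse.to f i) (Inverse.to f j) ≡ adj G i j

Empty : (n : ℕ) → Graph n
Empty n = record { adj = λ _ _ → false ; sym = λ _ _ → refl ; irrefl = λ _ → refl }

KUnionE : (n c : ℕ) → Graph n
KUnionE n c = record { adj = a ; sym = s ; irrefl = r }
  where
    a : Fin n → Fin n → Bool
    a i j = not (i == j) ∧ ((toℕ i <ᵇ c) ∧ (toℕ j <ᵇ c))
    s : ∀ i j → a i j ≡ a j i
    s i j = cong₂ _∧_ (cong not (≡ᵇ-sym (toℕ i) (toℕ j)))
                      (∧-comm (toℕ i <ᵇ c) (toℕ j <ᵇ c))
    r : ∀ i → a i i ≡ false
    r i rewrite ≡ᵇ-refl (toℕ i) = refl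

StarUnionE : (n d : ℕ) → Graph n
StarUnionE n d = record { adj = a ; sym = s ; irrefl = r }
  where
    e : Fin n → Fin n → Bool
    e i j = (toℕ i ≡ᵇ 0) ∧ ((1 ≤ᵇ toℕ j) ∧ (toℕ j ≤ᵇ d))
    a : Fin n → Fin n → Bool
    a i j = e i j ∨ e j i
    s : ∀ i j → a i j ≡ a j i
    s i j = ∨-comm (e i j) (e j i)
    e-irr : ∀ x → ((x ≡ᵇ 0) ∧ ((1 ≤ᵇ x) ∧ (x ≤ᵇ d))) ≡ false
    e-irr zero = refl
    e-irr (suc x) = refl
    r : ∀ i → a i i ≡ false
    r i rewrite e-irr (toℕ i) = refl

{-# OPTIONS --safe #-}
-- Eliminating a simplicial vertex of degree d multiplies the chromatic polynomial by
-- x − d, so P(G,x) = Π (x − dᵢ) along a perfect elimination ordering.  The numbers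
-- S(G,k) are the coefficients of P in the falling factorial basis, 𝓑 is the sum of
-- these coefficients and 𝓣 their first moment.  Write a, b, c for the moments of order
-- 0, 1, 2 of the nonnegative coefficients of Q.  Passing from (x − d) Q to (x − e) Q with
-- e < d strictly decreases 𝓣 / 𝓑, because the cross difference is
-- (d − e)(a² + ac − b²) and b² ≤ ac.  The degrees of G contain 0, …, χ − 1, and at
-- least Δ of them are nonzero; lowering the other ones to 0, respectively Δ nonzero
-- ones to 1 and the rest to 0, yields the degrees of the two extremal graphs.
module Submission where

open import Defs hiding (sym; irrefl)
open import Data.Nat
open import Data.Nat.Properties
open import Data.Nat.ListAction using (product)
open import Data.Nat.Tactic.RingSolver using (solve-∀)
open import Data.Fin as Fin using (Fin; zero; suc; toℕ; fromℕ<; punchIn)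
open import Data.Fin.Properties as Finₚ using (toℕ-injective; toℕ<n; toℕ-fromℕ<; punchInᵢ≢i)
open import Data.Fin.Permutation as Perm using (Permutation′; _⟨$⟩ʳ_; _⟨$⟩ˡ_)
open import Data.Bool using (Bool; true; false; _∧_; _∨_; not; if_then_else_)
open import Data.Bool.Properties using (∨-identityʳ; ∧-zeroʳ; ∧-identityʳ; T-≡)
open import Data.Bool.ListAction using (all; any; and)
open import Data.List using (List; []; _∷_; _∷ʳ_; _++_; map; concatMap; allFin; tabulate; length)
open import Data.List.Properties using (map-++; map-∘; map-cong; length-++; ∷ʳ-injective)
open import Data.List.Relation.Unary.All using (All; []; _∷_)
open import Data.List.Relation.Unary.All.Properties using (∷ʳ⁻)
open import Data.Vec.Functional using (insertAt; removeAt) renaming (_∷_ to _◂_)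
open import Data.Vec.Functional.Properties using (insertAt-lookup; insertAt-punchIn)
open import Data.Product using (Σ; ∃; _×_; _,_; proj₁; proj₂)
open import Data.Sum using (_⊎_; inj₁; inj₂)
open import Function using (_∘_; id; case_of_)
open import Function.Bundles using (_⇔_; mk⇔; Equivalence)
open import Relation.Nullary using (¬_; yes; no; contradiction)
open import Relation.Nullary.Decidable using (dec-true; dec-false)
open import Relation.Binary.Definitions using (tri<; tri≈; tri>)
open import Relation.Binary.PropositionalEquality
open import Algebra.Properties.Semiring.Sum +-*-semiring
  using (sum; sum-cong-≗; ∑-distrib-+; ∑-comm; sum-permute; sum-remove; *-distribˡ-sum)

-- Subtraction in ℕ is truncated, and multiplication by x - d is faithful only on coefficients that
-- vanish below d. So each list of degrees carries the invariant `Valid`, and degrees may not be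
-- permuted or lowered freely: the extremal lists are built position by position from the list of G,
-- and a changed factor is commuted to the end, where two products differing only there can be
-- compared. The intermediate lists need not belong to any graph, so the comparison lives on
-- coefficient sequences and only its two ends are tied to graphs, through the uniqueness of falling
-- factorial coefficients. Each lowering is strict, so equal averages force equal lists. The
-- chromatic polynomial does not determine the graph (all forests with q edges on n vertices share
-- one), so in the equality case the graph is recovered from the elimination ordering itself, and
-- for the star also from a vertex of degree Δ.

-- Quadratic inequalities for moments

2xy≤x²+y² : ∀ x y → 2 * (x * y) ≤ x * x + y * y
2xy≤x²+y² x y with ≤-total x y
... | inj₁ x≤y = subst (λ z → 2 * (x * z) ≤ x * x + z * z) (m+[n∸m]≡n x≤y)
  (subst (2 * (x * (x + (y ∸ x))) ≤_) (sym (eq x (y ∸ x))) (m≤m+n _ _))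
  where
  eq : ∀ x e → x * x + (x + e) * (x + e) ≡ 2 * (x * (x + e)) + e * e
  eq = solve-∀
... | inj₂ y≤x = subst (λ z → 2 * (z * y) ≤ z * z + y * y) (m+[n∸m]≡n y≤x)
  (subst (2 * ((y + (x ∸ y)) * y) ≤_) (sym (eq y (x ∸ y))) (m≤m+n _ _))
  where
  eq : ∀ x e → (x + e) * (x + e) + x * x ≡ 2 * ((x + e) * x) + e * e
  eq = solve-∀

module _ where
  open ≤-Reasoning

  -- Expand Σ wᵢ (y - xᵢ)² ≥ 0 and move the mixed term to the left. In `cauchy-schwarz` this bounds
  -- the cross term, with y the point split off.
  weighted-square-nonneg : ∀ {n} (w x : Fin n → ℕ) y →
    2 * (y * sum (λ i → x i * w i)) ≤ y * y * sum w + sum (λ i → x i * (x i * w i))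
  weighted-square-nonneg {zero}  w x y = ≤-reflexive (eq y)
    where
    eq : ∀ y → 2 * (y * 0) ≡ y * y * 0 + 0
    eq = solve-∀
  weighted-square-nonneg {suc n} w x y = begin
    2 * (y * (x₀ * w₀ + B))                         ≡⟨ eq₁ y x₀ w₀ B ⟩
    2 * (y * x₀) * w₀ + 2 * (y * B)                 ≤⟨ +-mono-≤ (*-monoˡ-≤ w₀ (2xy≤x²+y² y x₀)) (weighted-square-nonneg (w ∘ suc) (x ∘ suc) y) ⟩
    (y * y + x₀ * x₀) * w₀ + (y * y * A + C)        ≡⟨ eq₂ y x₀ w₀ A C ⟩
    y * y * (w₀ + A) + (x₀ * (x₀ * w₀) + C)         ∎
    where
    x₀ = x zero
    w₀ = w zero
    A = sum (w ∘ suc)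
    B = sum (λ i → x (suc i) * w (suc i))
    C = sum (λ i → x (suc i) * (x (suc i) * w (suc i)))
    eq₁ : ∀ y x w B → 2 * (y * (x * w + B)) ≡ 2 * (y * x) * w + 2 * (y * B)
    eq₁ = solve-∀
    eq₂ : ∀ y x w A C → (y * y + x * x) * w + (y * y * A + C) ≡ y * y * (w + A) + (x * (x * w) + C)
    eq₂ = solve-∀

  -- A point x₀ of weight w₀ enlarges the gap between the two sides by w₀ Σ wᵢ (x₀ - xᵢ)², so
  -- induction on the number of points works.
  cauchy-schwarz : ∀ {n} (w x : Fin n → ℕ) →
    sum (λ i → x i * w i) * sum (λ i → x i * w i) ≤ sum w * sum (λ i → x i * (x i * w i))
  cauchy-schwarz {zero}  w x = z≤n
  cauchy-schwarz {suc n} w x = begin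
    (x₀ * w₀ + B) * (x₀ * w₀ + B)                             ≡⟨ eq₁ x₀ w₀ B ⟩
    B * B + w₀ * (2 * (x₀ * B)) + x₀ * w₀ * (x₀ * w₀)         ≤⟨ +-monoˡ-≤ _ (+-mono-≤ (cauchy-schwarz (w ∘ suc) (x ∘ suc)) (*-monoʳ-≤ w₀ (weighted-square-nonneg (w ∘ suc) (x ∘ suc) x₀))) ⟩
    A * C + w₀ * (x₀ * x₀ * A + C) + x₀ * w₀ * (x₀ * w₀)      ≡⟨ eq₂ x₀ w₀ A C ⟩
    (w₀ + A) * (x₀ * (x₀ * w₀) + C)                           ∎
    where
    x₀ = x zero
    w₀ = w zero
    A = sum (w ∘ suc)
    B = sum (λ i → x (suc i) * w (suc i))
    C = sum (λ i → x (suc i) * (x (suc i) * w (suc i)))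
    eq₁ : ∀ x w B → (x * w + B) * (x * w + B) ≡ B * B + w * (2 * (x * B)) + x * w * (x * w)
    eq₁ = solve-∀
    eq₂ : ∀ x w A C → A * C + w * (x * x * A + C) + x * w * (x * w) ≡ (w + A) * (x * (x * w) + C)
    eq₂ = solve-∀

  -- With a, b, c the first three moments, the difference of the two sides is
  -- δ (a² + ac − b²).
  ratio-increases : ∀ {a b c B T} d δ → 1 ≤ a → b * b ≤ a * c →
    B + d * a ≡ a + b → T + d * b ≡ a + b + c →
    (T + suc δ * b) * B < T * (B + suc δ * a)
  ratio-increases {a} {b} {c} {B} {T} d δ 1≤a bb≤ac eB eT = begin-strict
    (T + suc δ * b) * B          ≡⟨ eq₁ T (suc δ) b B ⟩
    T * B + suc δ * (b * B)      <⟨ +-monoʳ-< (T * B) (*-monoʳ-< (suc δ) core) ⟩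
    T * B + suc δ * (a * T)      ≡⟨ eq₂ T (suc δ) a B ⟩
    T * (B + suc δ * a)          ∎
    where
    eq₁ : ∀ T s b B → (T + s * b) * B ≡ T * B + s * (b * B)
    eq₁ = solve-∀
    eq₂ : ∀ T s a B → T * B + s * (a * T) ≡ T * (B + s * a)
    eq₂ = solve-∀
    eq₃ : ∀ a b B d → b * B + d * (a * b) ≡ b * (B + d * a)
    eq₃ = solve-∀
    eq₄ : ∀ a b → b * (a + b) ≡ a * b + b * b
    eq₄ = solve-∀
    eq₅ : ∀ a b c → a * a + (a * b + a * c) ≡ a * (a + b + c)
    eq₅ = solve-∀
    eq₆ : ∀ a b T d → a * (T + d * b) ≡ a * T + d * (a * b)
    eq₆ = solve-∀
    core : b * B < a * T
    core = +-cancelʳ-< (d * (a * b)) (b * B) (a * T) (begin-strict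
      b * B + d * (a * b)       ≡⟨ eq₃ a b B d ⟩
      b * (B + d * a)           ≡⟨ cong (b *_) eB ⟩
      b * (a + b)               ≡⟨ eq₄ a b ⟩
      a * b + b * b             ≤⟨ +-monoʳ-≤ (a * b) bb≤ac ⟩
      a * b + a * c             <⟨ m<n+m (a * b + a * c) (*-mono-≤ 1≤a 1≤a) ⟩
      a * a + (a * b + a * c)   ≡⟨ eq₅ a b c ⟩
      a * (a + b + c)           ≡⟨ cong (a *_) eT ⟨
      a * (T + d * b)           ≡⟨ eq₆ a b T d ⟩
      a * T + d * (a * b)       ∎)

  -- Multiply the strict inequality by b₁, which keeps it strict, and the other one by b₃, then
  -- cancel b₂. For fractions it reads t₃/b₃ < t₂/b₂ ≤ t₁/b₁.
  cross-trans : ∀ {t₁ b₁ t₂ b₂ t₃ b₃} → 1 ≤ b₁ → t₃ * b₂ < t₂ * b₃ → t₂ * b₁ ≤ t₁ * b₂ → t₃ * b₁ < t₁ * b₃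
  cross-trans {t₁} {b₁@(suc _)} {t₂} {b₂} {t₃} {b₃} _ p q = *-cancelʳ-< b₂ _ _ (begin-strict
    t₃ * b₁ * b₂    ≡⟨ eq t₃ b₁ b₂ ⟩
    t₃ * b₂ * b₁    <⟨ *-monoˡ-< b₁ p ⟩
    t₂ * b₃ * b₁    ≡⟨ eq t₂ b₃ b₁ ⟩
    t₂ * b₁ * b₃    ≤⟨ *-monoˡ-≤ b₃ q ⟩
    t₁ * b₂ * b₃    ≡⟨ eq t₁ b₂ b₃ ⟩
    t₁ * b₃ * b₂    ∎)
    where
    eq : ∀ x y z → x * y * z ≡ x * z * y
    eq = solve-∀

open ≡-Reasoning

-- Boolean tests and finite sums

⟦_⟧ : Bool → ℕ
⟦ b ⟧ = if b then 1 else 0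

⟦⟧-∧ : ∀ a b → ⟦ a ∧ b ⟧ ≡ ⟦ a ⟧ * ⟦ b ⟧
⟦⟧-∧ true  b = sym (+-identityʳ ⟦ b ⟧)
⟦⟧-∧ false b = refl

bool-ext : ∀ {a b} → (a ≡ true → b ≡ true) → (b ≡ true → a ≡ true) → a ≡ b
bool-ext {true}          f g = sym (f refl)
bool-ext {false} {true}  f g = g refl
bool-ext {false} {false} f g = refl

≢true⇒false : ∀ {b} → ¬ (b ≡ true) → b ≡ false
≢true⇒false {true}  h = contradiction refl h
≢true⇒false {false} h = refl

∧-true : ∀ {a b} → a ∧ b ≡ true → a ≡ true × b ≡ true
∧-true {true} e = refl , e

≡ᵇ-sound : ∀ {x y} → (x ≡ᵇ y) ≡ true → x ≡ y
≡ᵇ-sound {x} {y} e = ≡ᵇ⇒≡ x y (Equivalence.from T-≡ e)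

≡ᵇ-complete : ∀ {x y} → x ≡ y → (x ≡ᵇ y) ≡ true
≡ᵇ-complete {x} {y} e = Equivalence.to T-≡ (≡⇒≡ᵇ x y e)

<ᵇ-sound : ∀ {x y} → (x <ᵇ y) ≡ true → x < y
<ᵇ-sound {x} {y} e = <ᵇ⇒< x y (Equivalence.from T-≡ e)

<ᵇ-complete : ∀ {x y} → x < y → (x <ᵇ y) ≡ true
<ᵇ-complete l = Equivalence.to T-≡ (<⇒<ᵇ l)

<ᵇ-false : ∀ {x y} → y ≤ x → (x <ᵇ y) ≡ false
<ᵇ-false l = ≢true⇒false (λ e → <-irrefl refl (<-≤-trans (<ᵇ-sound e) l))

≡ᵇ-false : ∀ {x y} → x ≢ y → (x ≡ᵇ y) ≡ false
≡ᵇ-false h = ≢true⇒false (h ∘ ≡ᵇ-sound)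

≡ᵇ-cong : ∀ {x y u v} → (x ≡ y → u ≡ v) → (u ≡ v → x ≡ y) → (x ≡ᵇ y) ≡ (u ≡ᵇ v)
≡ᵇ-cong f g = bool-ext (≡ᵇ-complete ∘ f ∘ ≡ᵇ-sound) (≡ᵇ-complete ∘ g ∘ ≡ᵇ-sound)

module _ {a} {A : Set a} where

  all-tabulate⁻ : ∀ {n} (p : A → Bool) (h : Fin n → A) → all p (tabulate h) ≡ true → ∀ i → p (h i) ≡ true
  all-tabulate⁻ p h e zero    = proj₁ (∧-true e)
  all-tabulate⁻ p h e (suc i) = all-tabulate⁻ p (h ∘ suc) (proj₂ (∧-true {p (h zero)} e)) i

  all-tabulate⁺ : ∀ {n} (p : A → Bool) (h : Fin n → A) → (∀ i → p (h i) ≡ true) → all p (tabulate h) ≡ true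
  all-tabulate⁺ {zero}  p h f = refl
  all-tabulate⁺ {suc n} p h f rewrite f zero = all-tabulate⁺ p (h ∘ suc) (f ∘ suc)

  any-tabulate⁻ : ∀ {n} (p : A → Bool) (h : Fin n → A) → any p (tabulate h) ≡ true → ∃ λ i → p (h i) ≡ true
  any-tabulate⁻ {suc n} p h e with p (h zero) in eq
  ... | true  = zero , eq
  ... | false = let i , e′ = any-tabulate⁻ p (h ∘ suc) e in suc i , e′

  any-tabulate⁺ : ∀ {n} (p : A → Bool) (h : Fin n → A) i → p (h i) ≡ true → any p (tabulate h) ≡ true
  any-tabulate⁺ p h zero    e rewrite e = refl
  any-tabulate⁺ p h (suc i) e with p (h zero)
  ... | true  = refl
  ... | false = any-tabulate⁺ p (h ∘ suc) i e

  all-cong : ∀ {p q : A → Bool} → p ≗ q → all p ≗ all q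
  all-cong e xs = cong and (map-cong e xs)

all⁻ : ∀ {n} (p : Fin n → Bool) → all p (allFin n) ≡ true → ∀ i → p i ≡ true
all⁻ p = all-tabulate⁻ p id

all⁺ : ∀ {n} (p : Fin n → Bool) → (∀ i → p i ≡ true) → all p (allFin n) ≡ true
all⁺ p = all-tabulate⁺ p id

any⁻ : ∀ {n} (p : Fin n → Bool) → any p (allFin n) ≡ true → ∃ λ i → p i ≡ true
any⁻ p = any-tabulate⁻ p id

any⁺ : ∀ {n} (p : Fin n → Bool) i → p i ≡ true → any p (allFin n) ≡ true
any⁺ p = any-tabulate⁺ p id

sum-zero : ∀ {n} (t : Fin n → ℕ) → (∀ i → t i ≡ 0) → sum t ≡ 0
sum-zero {zero}  t h = refl
sum-zero {suc n} t h = cong₂ _+_ (h zero) (sum-zero (t ∘ suc) (h ∘ suc))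

sum-const : ∀ n x → sum {n} (λ _ → x) ≡ n * x
sum-const zero    x = refl
sum-const (suc n) x = cong (x +_) (sum-const n x)

sum-split : ∀ j r (G : ℕ → ℕ) →
  sum {j + r} (G ∘ toℕ) ≡ sum {j} (G ∘ toℕ) + sum {r} (λ b → G (j + toℕ b))
sum-split zero    r G = refl
sum-split (suc j) r G =
  trans (cong (G 0 +_) (sum-split j r (G ∘ suc))) (sym (+-assoc (G 0) _ _))

sum-positive : ∀ {n} (t : Fin n → ℕ) i → 1 ≤ t i → 1 ≤ sum t
sum-positive t zero    l = ≤-trans l (m≤m+n (t zero) _)
sum-positive t (suc i) l = ≤-trans (sum-positive (t ∘ suc) i l) (m≤n+m _ (t zero))

sum-positive⁻ : ∀ {n} (t : Fin n → ℕ) → 1 ≤ sum t → ∃ λ i → 1 ≤ t i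
sum-positive⁻ {suc n} t l with t zero in eq
... | suc x = zero , subst (1 ≤_) (sym eq) (s≤s z≤n)
... | zero  = let i , h = sum-positive⁻ (t ∘ suc) l in suc i , h

countTrue-++ : ∀ xs ys → countTrue (xs ++ ys) ≡ countTrue xs + countTrue ys
countTrue-++ []       ys = refl
countTrue-++ (x ∷ xs) ys = trans (cong (⟦ x ⟧ +_) (countTrue-++ xs ys)) (sym (+-assoc ⟦ x ⟧ _ _))

countTrue-tabulate : ∀ {a} {A : Set a} {n} (p : A → Bool) (h : Fin n → A) →
  countTrue (map p (tabulate h)) ≡ sum (λ i → ⟦ p (h i) ⟧)
countTrue-tabulate {n = zero}  p h = refl
countTrue-tabulate {n = suc n} p h = cong (⟦ p (h zero) ⟧ +_) (countTrue-tabulate p (h ∘ suc))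

countTrue-concatMap : ∀ {a b} {A : Set a} {B : Set b} {n} (p : B → Bool) (F : A → List B) (h : Fin n → A) →
  countTrue (map p (concatMap F (tabulate h))) ≡ sum (λ i → countTrue (map p (F (h i))))
countTrue-concatMap {n = zero}  p F h = refl
countTrue-concatMap {n = suc n} p F h = begin
  countTrue (map p (F (h zero) ++ concatMap F (tabulate (h ∘ suc))))
    ≡⟨ cong countTrue (map-++ p (F (h zero)) _) ⟩
  countTrue (map p (F (h zero)) ++ map p (concatMap F (tabulate (h ∘ suc))))
    ≡⟨ countTrue-++ (map p (F (h zero))) _ ⟩
  countTrue (map p (F (h zero))) + countTrue (map p (concatMap F (tabulate (h ∘ suc))))
    ≡⟨ cong (countTrue (map p (F (h zero))) +_) (countTrue-concatMap p F (h ∘ suc)) ⟩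
  countTrue (map p (F (h zero))) + sum (λ i → countTrue (map p (F (h (suc i))))) ∎

sumFun : ∀ n {k} → ((Fin n → Fin k) → ℕ) → ℕ
sumFun zero    Φ = Φ (λ ())
sumFun (suc n) Φ = sum (λ a → sumFun n (λ c → Φ (cons a c)))

countTrue-allFuns : ∀ n {k} (ψ : (Fin n → Fin k) → Bool) →
  countTrue (map ψ (allFuns n k)) ≡ sumFun n (λ c → ⟦ ψ c ⟧)
countTrue-allFuns zero    ψ = +-identityʳ _
countTrue-allFuns (suc n) {k} ψ =
  trans (countTrue-concatMap ψ (λ a → map (cons a) (allFuns n k)) id)
        (sum-cong-≗ λ a → trans (cong countTrue (sym (map-∘ (allFuns n k)))) (countTrue-allFuns n (ψ ∘ cons a)))

sumFun-cong : ∀ n {k} {Φ Ψ : (Fin n → Fin k) → ℕ} → (∀ c → Φ c ≡ Ψ c) → sumFun n Φ ≡ sumFun n Ψ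
sumFun-cong zero    h = h _
sumFun-cong (suc n) h = sum-cong-≗ λ a → sumFun-cong n (h ∘ cons a)

sumFun-zero : ∀ n {k} → sumFun n {k} (λ _ → 0) ≡ 0
sumFun-zero zero    = refl
sumFun-zero (suc n) {k} = sum-zero {k} _ (λ _ → sumFun-zero n {k})

-- Colorings that agree at every vertex, such as `toℕ ∘ cons a c` and `toℕ a ◂ (toℕ ∘ c)`, are not
-- identified as functions, so weights have to respect pointwise equality.
Ext : ∀ {n} {A : Set} → ((Fin n → A) → ℕ) → Set
Ext {n} {A} Φ = ∀ {f g : Fin n → A} → f ≗ g → Φ f ≡ Φ g

cons-cong : ∀ {n k} (a : Fin k) {f g : Fin n → Fin k} → f ≗ g → cons a f ≗ cons a g
cons-cong a h zero    = refl
cons-cong a h (suc i) = h i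

◂-cong : ∀ {n} {A : Set} (a : A) {f g : Fin n → A} → f ≗ g → (a ◂ f) ≗ (a ◂ g)
◂-cong a h zero    = refl
◂-cong a h (suc i) = h i

toℕ-cons : ∀ {n k} (a : Fin k) (c : Fin n → Fin k) → (toℕ ∘ cons a c) ≗ (toℕ a ◂ (toℕ ∘ c))
toℕ-cons a c zero    = refl
toℕ-cons a c (suc i) = refl

sumFun-recolor : ∀ n {k} (π : Permutation′ k) (Φ : (Fin n → Fin k) → ℕ) → Ext Φ →
  sumFun n Φ ≡ sumFun n (λ c → Φ (λ i → π ⟨$⟩ʳ c i))
sumFun-recolor zero    π Φ e = e λ ()
sumFun-recolor (suc n) π Φ e = begin
  sum (λ a → sumFun n (λ c → Φ (cons a c)))
    ≡⟨ sum-permute _ π ⟩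
  sum (λ a → sumFun n (λ c → Φ (cons (π ⟨$⟩ʳ a) c)))
    ≡⟨ sum-cong-≗ (λ a → trans (sumFun-recolor n π (λ c → Φ (cons (π ⟨$⟩ʳ a) c)) (λ h → e (cons-cong _ h)))
                               (sumFun-cong n λ c → e λ { zero → refl ; (suc i) → refl })) ⟩
  sum (λ a → sumFun n (λ c → Φ (λ i → π ⟨$⟩ʳ cons a c i))) ∎

-- φ only depends on the color classes and on which vertices carry each of
-- the colors 0 , … , j − 1.
ColorBlind : ∀ {n} → ℕ → ((Fin n → ℕ) → ℕ) → Set
ColorBlind j φ = ∀ f g →
  (∀ x y → (f x ≡ᵇ f y) ≡ (g x ≡ᵇ g y)) →
  (∀ x b → b < j → (f x ≡ᵇ b) ≡ (g x ≡ᵇ b)) → φ f ≡ φ g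

blind⇒ext : ∀ {n j} {φ : (Fin n → ℕ) → ℕ} → ColorBlind j φ → Ext φ
blind⇒ext s h = s _ _ (λ x y → cong₂ _≡ᵇ_ (h x) (h y)) (λ x b _ → cong (_≡ᵇ b) (h x))

blind-old : ∀ {n j a} {φ : (Fin (suc n) → ℕ) → ℕ} → a < j → ColorBlind j φ → ColorBlind j (φ ∘ (a ◂_))
blind-old {a = a} a<j s f g ker col = s _ _ ker′ col′
  where
  ker′ : ∀ x y → ((a ◂ f) x ≡ᵇ (a ◂ f) y) ≡ ((a ◂ g) x ≡ᵇ (a ◂ g) y)
  ker′ zero    zero    = refl
  ker′ zero    (suc y) = trans (≡ᵇ-sym a (f y)) (trans (col y a a<j) (≡ᵇ-sym (g y) a))
  ker′ (suc x) zero    = col x a a<j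
  ker′ (suc x) (suc y) = ker x y
  col′ : ∀ x b → b < _ → ((a ◂ f) x ≡ᵇ b) ≡ ((a ◂ g) x ≡ᵇ b)
  col′ zero    b l = refl
  col′ (suc x) b l = col x b l

blind-suc : ∀ {n j} {φ : (Fin n → ℕ) → ℕ} → ColorBlind j φ → ColorBlind (suc j) φ
blind-suc s f g ker col = s f g ker (λ x b l → col x b (m<n⇒m<1+n l))

blind-new : ∀ {n j} {φ : (Fin (suc n) → ℕ) → ℕ} → ColorBlind j φ → ColorBlind (suc j) (φ ∘ (j ◂_))
blind-new s = blind-old ≤-refl (blind-suc s)

permutation-injective : ∀ {n} (π : Permutation′ n) {i j} → π ⟨$⟩ʳ i ≡ π ⟨$⟩ʳ j → i ≡ j
permutation-injective π e = trans (sym (Perm.inverseˡ π)) (trans (cong (π ⟨$⟩ˡ_) e) (Perm.inverseˡ π))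

transpose-right : ∀ {k} (a b : Fin k) → Perm.transpose a b ⟨$⟩ʳ b ≡ a
transpose-right a b with b Finₚ.≟ a
... | yes b≡a = b≡a
... | no  _ rewrite dec-true (b Finₚ.≟ b) refl = refl

transpose-other : ∀ {k} {a b x : Fin k} → x ≢ a → x ≢ b → Perm.transpose a b ⟨$⟩ʳ x ≡ x
transpose-other {a = a} {b} {x} x≢a x≢b
  rewrite dec-false (x Finₚ.≟ a) x≢a | dec-false (x Finₚ.≟ b) x≢b = refl

-- Exchanging `a` and `b` permutes the colorings, preserves their classes and fixes every color
-- below j, so φ cannot tell the two sides apart.
unused-colors-symmetric : ∀ n {k j} (φ : (Fin (suc n) → ℕ) → ℕ) → ColorBlind j φ →
  (a b : Fin k) → j ≤ toℕ a → j ≤ toℕ b →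
  sumFun n {k} (λ c → φ (toℕ a ◂ (toℕ ∘ c))) ≡ sumFun n {k} (λ c → φ (toℕ b ◂ (toℕ ∘ c)))
unused-colors-symmetric n {k} {j} φ s a b j≤a j≤b = begin
  sumFun n (λ c → φ (toℕ a ◂ (toℕ ∘ c)))
    ≡⟨ sumFun-recolor n π _ (λ h → blind⇒ext s (◂-cong (toℕ a) (cong toℕ ∘ h))) ⟩
  sumFun n (λ c → φ (toℕ a ◂ (toℕ ∘ (π ⟨$⟩ʳ_) ∘ c)))
    ≡⟨ sumFun-cong n (λ c → blind⇒ext s λ { zero → cong toℕ (sym (transpose-right a b)) ; (suc i) → refl }) ⟩
  sumFun n (λ c → φ (toℕ ∘ (π ⟨$⟩ʳ_) ∘ (b ◂ c)))
    ≡⟨ sumFun-cong n (λ c → s _ _ (λ x y → ≡ᵇ-cong (cong toℕ ∘ permutation-injective π {(b ◂ c) x} {(b ◂ c) y} ∘ toℕ-injective)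
                                                      (cong (toℕ ∘ (π ⟨$⟩ʳ_)) ∘ toℕ-injective))
                                  (λ x d d<j → ≡ᵇ-cong (fixes d d<j ((b ◂ c) x)) (fixed d d<j ((b ◂ c) x)))) ⟩
  sumFun n (λ c → φ (toℕ ∘ (b ◂ c)))
    ≡⟨ sumFun-cong n (λ c → blind⇒ext s λ { zero → refl ; (suc i) → refl }) ⟩
  sumFun n (λ c → φ (toℕ b ◂ (toℕ ∘ c))) ∎
  where
  π = Perm.transpose a b
  old : ∀ {x : Fin k} → toℕ x < j → π ⟨$⟩ʳ x ≡ x
  old l = transpose-other (λ { refl → <⇒≱ l j≤a }) (λ { refl → <⇒≱ l j≤b })
  fixed : ∀ d → d < j → ∀ x → toℕ x ≡ d → toℕ (π ⟨$⟩ʳ x) ≡ d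
  fixed d d<j x refl = cong toℕ (old d<j)
  fixes : ∀ d → d < j → ∀ x → toℕ (π ⟨$⟩ʳ x) ≡ d → toℕ x ≡ d
  fixes d d<j x e =
    trans (cong toℕ (permutation-injective π (sym (old (subst (_< j) (sym e) d<j))))) e

-- Canonical colorings and the chromatic polynomial

fall : ℕ → ℕ → ℕ
fall r       zero    = 1
fall zero    (suc t) = 0
fall (suc r) (suc t) = suc r * fall r t

-- Total weight of the canonical colorings of n further vertices that use t
-- new colors besides the j colors already introduced.
canonicalSum : ∀ n → ℕ → ℕ → ((Fin n → ℕ) → ℕ) → ℕ
canonicalSum zero    j zero    φ = φ λ ()
canonicalSum zero    j (suc t) φ = 0
canonicalSum (suc n) j zero    φ = sum {j} (λ a → canonicalSum n j 0 (φ ∘ (toℕ a ◂_)))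
canonicalSum (suc n) j (suc t) φ =
  sum {j} (λ a → canonicalSum n j (suc t) (φ ∘ (toℕ a ◂_))) + canonicalSum n (suc j) t (φ ∘ (j ◂_))

-- The first vertex takes one of the j introduced colors or one of the r others. The latter all
-- contribute the same, so color j stands for them, and the factor `suc r′` turns `fall r′ t` into
-- `fall (suc r′) (suc t)`. The free bound N makes the ranges match: the second branch has spent a
-- new color and runs one step shorter.
sumFun-canonical : ∀ n k j r N (φ : (Fin n → ℕ) → ℕ) → ColorBlind j φ → k ≡ j + r → n ≤ N →
  sumFun n {k} (λ c → φ (toℕ ∘ c)) ≡ sum {suc N} (λ t → fall r (toℕ t) * canonicalSum n j (toℕ t) φ)
sumFun-canonical zero k j r N φ s eq n≤N = begin
  φ (λ x → toℕ _)         ≡⟨ blind⇒ext s (λ ()) ⟩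
  φ (λ ())                ≡⟨ +-identityʳ _ ⟨
  φ (λ ()) + 0            ≡⟨ +-identityʳ _ ⟨
  φ (λ ()) + 0 + 0        ≡⟨ cong (φ (λ ()) + 0 +_) (sum-zero {N} (λ t → fall r (suc (toℕ t)) * 0) (λ t → *-zeroʳ (fall r (suc (toℕ t))))) ⟨
  φ (λ ()) + 0 + sum {N} (λ t → fall r (suc (toℕ t)) * 0) ∎
sumFun-canonical (suc n) k j r (suc N) φ s refl (s≤s n≤N) = begin
  sum {k} (λ a → sumFun n (λ c → φ (toℕ ∘ cons a c)))
    ≡⟨ sum-cong-≗ {k} (λ a → sumFun-cong n λ c → blind⇒ext s (toℕ-cons a c)) ⟩
  sum {j + r} (G ∘ toℕ)
    ≡⟨ sum-split j r G ⟩
  sum {j} (G ∘ toℕ) + sum {r} (λ b → G (j + toℕ b))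
    ≡⟨ cong₂ _+_ old (new r refl) ⟩
  sum {suc (suc N)} (λ t → fall r (toℕ t) * A (toℕ t)) + sum {suc N} (λ t → fall r (suc (toℕ t)) * B (toℕ t))
    ≡⟨ +-assoc (fall r 0 * A 0) _ _ ⟩
  fall r 0 * A 0 + (sum {suc N} (λ t → fall r (suc (toℕ t)) * A (suc (toℕ t))) + sum {suc N} (λ t → fall r (suc (toℕ t)) * B (toℕ t)))
    ≡⟨ cong (fall r 0 * A 0 +_) (sym (∑-distrib-+ {suc N} (λ t → fall r (suc (toℕ t)) * A (suc (toℕ t))) (λ t → fall r (suc (toℕ t)) * B (toℕ t)))) ⟩
  fall r 0 * A 0 + sum {suc N} (λ t → fall r (suc (toℕ t)) * A (suc (toℕ t)) + fall r (suc (toℕ t)) * B (toℕ t))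
    ≡⟨ cong (fall r 0 * A 0 +_) (sum-cong-≗ {suc N} λ t → sym (*-distribˡ-+ (fall r (suc (toℕ t))) (A (suc (toℕ t))) (B (toℕ t)))) ⟩
  sum {suc (suc N)} (λ t → fall r (toℕ t) * canonicalSum (suc n) j (toℕ t) φ) ∎
  where
  G A B : ℕ → ℕ
  G a = sumFun n {j + r} (λ c → φ (a ◂ (toℕ ∘ c)))
  A t = sum {j} (λ a → canonicalSum n j t (φ ∘ (toℕ a ◂_)))
  B t = canonicalSum n (suc j) t (φ ∘ (j ◂_))

  old : sum {j} (G ∘ toℕ) ≡ sum {suc (suc N)} (λ t → fall r (toℕ t) * A (toℕ t))
  old = begin
    sum {j} (λ a → G (toℕ a))
      ≡⟨ sum-cong-≗ {j} (λ a → sumFun-canonical n (j + r) j r (suc N) _ (blind-old (toℕ<n a) s) refl (m≤n⇒m≤1+n n≤N)) ⟩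
    sum {j} (λ a → sum {suc (suc N)} (λ t → fall r (toℕ t) * canonicalSum n j (toℕ t) (φ ∘ (toℕ a ◂_))))
      ≡⟨ ∑-comm {j} {suc (suc N)} (λ a t → fall r (toℕ t) * canonicalSum n j (toℕ t) (φ ∘ (toℕ a ◂_))) ⟩
    sum {suc (suc N)} (λ t → sum {j} (λ a → fall r (toℕ t) * canonicalSum n j (toℕ t) (φ ∘ (toℕ a ◂_))))
      ≡⟨ sum-cong-≗ {suc (suc N)} (λ t → sym (*-distribˡ-sum (fall r (toℕ t)) (λ (a : Fin j) → canonicalSum n j (toℕ t) (φ ∘ (toℕ a ◂_))))) ⟩
    sum {suc (suc N)} (λ t → fall r (toℕ t) * A (toℕ t)) ∎

  new : ∀ r′ → r ≡ r′ → sum {r′} (λ b → G (j + toℕ b)) ≡ sum {suc N} (λ t → fall r′ (suc (toℕ t)) * B (toℕ t))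
  new zero     eq = sym (sum-zero {suc N} (λ _ → 0) (λ _ → refl))
  new (suc r′) eq = begin
    sum {suc r′} (λ b → G (j + toℕ b))
      ≡⟨ sum-cong-≗ {suc r′} (λ b → same (toℕ b) (toℕ<n b)) ⟩
    sum {suc r′} (λ b → G j)
      ≡⟨ sum-const (suc r′) (G j) ⟩
    suc r′ * G j
      ≡⟨ cong (suc r′ *_) (sumFun-canonical n (j + r) (suc j) r′ N _ (blind-new s) (trans (cong (j +_) eq) (+-suc j r′)) n≤N) ⟩
    suc r′ * sum {suc N} (λ t → fall r′ (toℕ t) * B (toℕ t))
      ≡⟨ *-distribˡ-sum {suc N} (suc r′) (λ t → fall r′ (toℕ t) * B (toℕ t)) ⟩
    sum {suc N} (λ t → suc r′ * (fall r′ (toℕ t) * B (toℕ t)))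
      ≡⟨ sum-cong-≗ {suc N} (λ t → sym (*-assoc (suc r′) (fall r′ (toℕ t)) (B (toℕ t)))) ⟩
    sum {suc N} (λ t → fall (suc r′) (suc (toℕ t)) * B (toℕ t)) ∎
    where
    same : ∀ b → b < suc r′ → G (j + b) ≡ G j
    same b l = subst₂ (λ x y → G x ≡ G y) (toℕ-fromℕ< la) (toℕ-fromℕ< lb)
      (unused-colors-symmetric n φ s (fromℕ< la) (fromℕ< lb)
        (subst (j ≤_) (sym (toℕ-fromℕ< la)) (m≤m+n j b))
        (≤-reflexive (sym (toℕ-fromℕ< lb))))
      where
      la : j + b < j + r
      la = +-monoʳ-< j (subst (b <_) (sym eq) l)
      lb : j < j + r
      lb = subst (j <_) (trans (sym (+-suc j r′)) (cong (j +_) (sym eq))) (s≤s (m≤m+n j r′))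

-- Canonical colorings by order of first occurrence of the colors

or-imp : ∀ {a b} → (a ≡ true → b ≡ true) → not a ∨ b ≡ true
or-imp {true}  h = h refl
or-imp {false} h = refl

imp-or : ∀ {a b} → not a ∨ b ≡ true → a ≡ true → b ≡ true
imp-or {true} h e = h

and-true : ∀ {a b} → a ≡ true → b ≡ true → a ∧ b ≡ true
and-true refl refl = refl

-- For j ≤ k and f bounded by k: f introduces the colors j , … , k − 1, each
-- of them at some vertex, in increasing order.
introduces : ∀ n → ℕ → ℕ → (Fin n → ℕ) → Bool
introduces zero    j k f = j ≡ᵇ k
introduces (suc n) j k f =
  if f zero <ᵇ j then introduces n j k (f ∘ suc)
  else (if f zero ≡ᵇ j then introduces n (suc j) k (f ∘ suc) else false)

introduces-cong : ∀ n j k {f g : Fin n → ℕ} → f ≗ g → introduces n j k f ≡ introduces n j k g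
introduces-cong zero    j k h = refl
introduces-cong (suc n) j k {f} {g} h
  rewrite h zero | introduces-cong n j k (h ∘ suc) | introduces-cong n (suc j) k (h ∘ suc) = refl

introduces-old : ∀ {n j k a} {f : Fin n → ℕ} → a < j → introduces (suc n) j k (a ◂ f) ≡ introduces n j k f
introduces-old l rewrite <ᵇ-complete l = refl

introduces-new : ∀ {n j k} {f : Fin n → ℕ} → introduces (suc n) j k (j ◂ f) ≡ introduces n (suc j) k f
introduces-new {j = j} rewrite <ᵇ-false (≤-refl {j}) | ≡ᵇ-refl j = refl

introduces-gap : ∀ {n j k a} {f : Fin n → ℕ} → j < a → introduces (suc n) j k (a ◂ f) ≡ false
introduces-gap {j = j} l rewrite <ᵇ-false (<⇒≤ l) | ≡ᵇ-false (<⇒≢ l ∘ sym) = refl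

-- The test discards every coloring whose first vertex skips a color. What remains, the colors below
-- j and j itself, is the recursion of `canonicalSum`.
sumFun-introduces : ∀ n k j t (φ : (Fin n → ℕ) → ℕ) → Ext φ → k ≡ j + t →
  sumFun n {k} (λ c → φ (toℕ ∘ c) * ⟦ introduces n j k (toℕ ∘ c) ⟧) ≡ canonicalSum n j t φ
sumFun-introduces zero k j zero φ e refl rewrite ≡ᵇ-complete (sym (+-identityʳ j)) =
  trans (*-identityʳ _) (e λ ())
sumFun-introduces zero k j (suc t) φ e refl rewrite ≡ᵇ-false (m≢1+m+n j ∘ λ q → trans q (+-suc j t)) =
  *-zeroʳ (φ _)
sumFun-introduces (suc n) k j t φ e refl = begin
  sum {k} (λ a → sumFun n (λ c → φ (toℕ ∘ cons a c) * ⟦ introduces (suc n) j k (toℕ ∘ cons a c) ⟧))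
    ≡⟨ sum-cong-≗ {k} (λ a → sumFun-cong n λ c → cong₂ (λ x y → x * ⟦ y ⟧) (e (toℕ-cons a c)) (introduces-cong (suc n) j k (toℕ-cons a c))) ⟩
  sum {j + t} (G ∘ toℕ)
    ≡⟨ sum-split j t G ⟩
  sum {j} (G ∘ toℕ) + sum {t} (λ b → G (j + toℕ b))
    ≡⟨ cong₂ _+_ old (new t refl) ⟩
  sum {j} (λ a → canonicalSum n j t (φ ∘ (toℕ a ◂_))) + fresh t
    ≡⟨ fold t ⟩
  canonicalSum (suc n) j t φ ∎
  where
  G fresh : ℕ → ℕ
  G a = sumFun n {j + t} (λ c → φ (a ◂ (toℕ ∘ c)) * ⟦ introduces (suc n) j k (a ◂ (toℕ ∘ c)) ⟧)
  fresh zero    = 0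
  fresh (suc t) = canonicalSum n (suc j) t (φ ∘ (j ◂_))
  fold : ∀ t → sum {j} (λ a → canonicalSum n j t (φ ∘ (toℕ a ◂_))) + fresh t ≡ canonicalSum (suc n) j t φ
  fold zero    = +-identityʳ _
  fold (suc t) = refl
  old : sum {j} (G ∘ toℕ) ≡ sum {j} (λ a → canonicalSum n j t (φ ∘ (toℕ a ◂_)))
  old = sum-cong-≗ {j} λ a →
    trans (sumFun-cong n λ c → cong (λ b → φ (toℕ a ◂ (toℕ ∘ c)) * ⟦ b ⟧) (introduces-old {n} {j} {k} {toℕ a} {toℕ ∘ c} (toℕ<n a)))
          (sumFun-introduces n (j + t) j t _ (e ∘ ◂-cong (toℕ a)) refl)
  new : ∀ t′ → t ≡ t′ → sum {t′} (λ b → G (j + toℕ b)) ≡ fresh t′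
  new zero     eq = refl
  new (suc t′) eq = trans (cong₂ _+_ first (sum-zero {t′} _ rest)) (+-identityʳ _)
    where
    first : G (j + 0) ≡ fresh (suc t′)
    first = begin
      G (j + 0) ≡⟨ cong G (+-identityʳ j) ⟩
      G j       ≡⟨ (sumFun-cong n λ c → cong (λ b → φ (j ◂ (toℕ ∘ c)) * ⟦ b ⟧) (introduces-new {n} {j} {k} {toℕ ∘ c})) ⟩
      _         ≡⟨ sumFun-introduces n (j + t) (suc j) t′ _ (e ∘ ◂-cong j) (trans (cong (j +_) eq) (+-suc j t′)) ⟩
      fresh (suc t′) ∎
    rest : ∀ (b : Fin t′) → G (j + suc (toℕ b)) ≡ 0
    rest b = trans (sumFun-cong n λ c → trans (cong (λ x → φ ((j + suc (toℕ b)) ◂ (toℕ ∘ c)) * ⟦ x ⟧) (introduces-gap {n} {j} {k} {_} {toℕ ∘ c} (m<m+n j (s≤s z≤n)))) (*-zeroʳ (φ ((j + suc (toℕ b)) ◂ (toℕ ∘ c)))))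
                   (sumFun-zero n {j + t})

-- `Covers` and `FirstUses` are surjectivity and canonicity restricted to the colors from j on, a
-- form that survives removal of the first vertex.
Covers : ∀ {n} → ℕ → ℕ → (Fin n → ℕ) → Set
Covers j k f = ∀ a → j ≤ a → a < k → ∃ λ i → f i ≡ a

FirstUses : ∀ {n} → ℕ → (Fin n → ℕ) → Set
FirstUses j f = ∀ i a → j ≤ a → a < f i → ∃ λ i′ → toℕ i′ < toℕ i × f i′ ≡ a

introduces⁺ : ∀ n j k {f : Fin n → ℕ} → j ≤ k → (∀ i → f i < k) → Covers j k f → FirstUses j f →
  introduces n j k f ≡ true
introduces⁺ zero j k j≤k bd cov fst with m≤n⇒m<n∨m≡n j≤k
... | inj₁ j<k = case cov j ≤-refl j<k of λ ()
... | inj₂ j≡k = ≡ᵇ-complete j≡k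
introduces⁺ (suc n) j k {f} j≤k bd cov fst with <-cmp (f zero) j
... | tri< l _ _ rewrite <ᵇ-complete l = introduces⁺ n j k j≤k (bd ∘ suc) cov′ fst′
  where
  cov′ : Covers j k (f ∘ suc)
  cov′ a j≤a a<k with cov a j≤a a<k
  ... | zero  , refl = contradiction j≤a (<⇒≱ l)
  ... | suc i , e    = i , e
  fst′ : FirstUses j (f ∘ suc)
  fst′ i a j≤a a<f with fst (suc i) a j≤a a<f
  ... | zero   , _ , refl = contradiction j≤a (<⇒≱ l)
  ... | suc i′ , s≤s l′ , e = i′ , l′ , e
... | tri≈ _ refl _ rewrite <ᵇ-false (≤-refl {f zero}) | ≡ᵇ-refl (f zero) =
  introduces⁺ n (suc j) k (bd zero) (bd ∘ suc) cov′ fst′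
  where
  cov′ : Covers (suc j) k (f ∘ suc)
  cov′ a j<a a<k with cov a (<⇒≤ j<a) a<k
  ... | zero  , refl = contradiction j<a (<-irrefl refl)
  ... | suc i , e    = i , e
  fst′ : FirstUses (suc j) (f ∘ suc)
  fst′ i a j<a a<f with fst (suc i) a (<⇒≤ j<a) a<f
  ... | zero   , _ , refl = contradiction j<a (<-irrefl refl)
  ... | suc i′ , s≤s l′ , e = i′ , l′ , e
-- A first vertex colored above j would need color j at an earlier vertex.
... | tri> _ _ l = case fst zero j ≤-refl l of λ { (_ , () , _) }

introduces⁻ : ∀ n j k {f : Fin n → ℕ} → introduces n j k f ≡ true → Covers j k f × FirstUses j f
introduces⁻ zero j k e =
  (λ a j≤a a<k → contradiction (≤-<-trans j≤a a<k) (<-irrefl (≡ᵇ-sound e))) , λ ()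
introduces⁻ (suc n) j k {f} e with <-cmp (f zero) j
... | tri< l _ _ rewrite <ᵇ-complete l =
  (λ a j≤a a<k → let i , q = cov a j≤a a<k in suc i , q) ,
  λ { zero a j≤a a<f → contradiction (≤-<-trans j≤a a<f) (<-asym l)
    ; (suc i) a j≤a a<f → let i′ , l′ , q = fst i a j≤a a<f in suc i′ , s≤s l′ , q }
  where
  cov = proj₁ (introduces⁻ n j k e)
  fst = proj₂ (introduces⁻ n j k e)
... | tri≈ _ refl _ rewrite <ᵇ-false (≤-refl {f zero}) | ≡ᵇ-refl (f zero) = cov′ , fst′
  where
  cov = proj₁ (introduces⁻ n (suc j) k e)
  fst = proj₂ (introduces⁻ n (suc j) k e)
  cov′ : Covers j k f
  cov′ a j≤a a<k with m≤n⇒m<n∨m≡n j≤a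
  ... | inj₁ j<a = let i , q = cov a j<a a<k in suc i , q
  ... | inj₂ q   = zero , q
  fst′ : FirstUses j f
  fst′ zero    a j≤a a<f = contradiction (≤-<-trans j≤a a<f) (<-irrefl refl)
  fst′ (suc i) a j≤a a<f with m≤n⇒m<n∨m≡n j≤a
  ... | inj₁ j<a = let i′ , l′ , q = fst i a j<a a<f in suc i′ , s≤s l′ , q
  ... | inj₂ q   = zero , s≤s z≤n , q
... | tri> _ _ l rewrite <ᵇ-false (<⇒≤ l) | ≡ᵇ-false (<⇒≢ l ∘ sym) = contradiction e λ ()

surj-canonical : ∀ {n k} (c : Fin n → Fin k) → (surjᵇ c ∧ canonicalᵇ c) ≡ introduces n 0 k (toℕ ∘ c)
surj-canonical {n} {k} c = bool-ext to from
  where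
  to : surjᵇ c ∧ canonicalᵇ c ≡ true → introduces n 0 k (toℕ ∘ c) ≡ true
  to e = introduces⁺ n 0 k z≤n (toℕ<n ∘ c) cov fst
    where
    sur = proj₁ (∧-true e)
    can = proj₂ (∧-true {surjᵇ c} e)
    cov : Covers 0 k (toℕ ∘ c)
    cov a _ a<k = let i , q = any⁻ _ (all⁻ _ sur (fromℕ< a<k)) in i , trans (≡ᵇ-sound q) (toℕ-fromℕ< a<k)
    fst : FirstUses 0 (toℕ ∘ c)
    fst i a _ a<c =
      let a<k = <-trans a<c (toℕ<n (c i))
          h = all⁻ _ (all⁻ _ can i) (fromℕ< a<k)
          i′ , q = any⁻ _ (imp-or h (<ᵇ-complete (subst (_< toℕ (c i)) (sym (toℕ-fromℕ< a<k)) a<c)))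
          q₁ , q₂ = ∧-true q
      in i′ , <ᵇ-sound q₁ , trans (≡ᵇ-sound q₂) (toℕ-fromℕ< a<k)
  from : introduces n 0 k (toℕ ∘ c) ≡ true → surjᵇ c ∧ canonicalᵇ c ≡ true
  from e = and-true
    (all⁺ _ λ a → let i , q = cov (toℕ a) z≤n (toℕ<n a) in any⁺ (λ i → c i == a) i (≡ᵇ-complete q))
    (all⁺ _ λ i → all⁺ _ λ a → or-imp λ l →
      let i′ , l′ , q = fst i (toℕ a) z≤n (<ᵇ-sound l) in
      any⁺ (λ x → (toℕ x <ᵇ toℕ i) ∧ (c x == a)) i′ (and-true (<ᵇ-complete l′) (≡ᵇ-complete q)))
    where
    cov = proj₁ (introduces⁻ n 0 k e)
    fst = proj₂ (introduces⁻ n 0 k e)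

-- The Boolean test properᵇ with colors in ℕ; properᵇ G c unfolds to
-- properℕ G (toℕ ∘ c).
properℕ : ∀ {n} → Graph n → (Fin n → ℕ) → Bool
properℕ {n} G f = all (λ i → all (λ j → not (adj G i j) ∨ not (f i ≡ᵇ f j)) (allFin n)) (allFin n)

properℕ-blind : ∀ {n} (G : Graph n) → ColorBlind 0 (λ f → ⟦ properℕ G f ⟧)
properℕ-blind {n} G f g ker _ = cong ⟦_⟧ (all-cong (λ i → all-cong (λ j → cong (λ b → not (adj G i j) ∨ not b) (ker i j)) (allFin n)) (allFin n))

properℕ-ext : ∀ {n} (G : Graph n) → Ext (λ f → ⟦ properℕ G f ⟧)
properℕ-ext G = blind⇒ext (properℕ-blind G)

properℕ⁺ : ∀ {n} (G : Graph n) {f : Fin n → ℕ} → (∀ i j → adj G i j ≡ true → f i ≢ f j) → properℕ G f ≡ true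
properℕ⁺ G h = all⁺ _ λ i → all⁺ _ λ j → or-imp λ a → cong not (≡ᵇ-false (h i j a))

properℕ⁻ : ∀ {n} (G : Graph n) {f : Fin n → ℕ} → properℕ G f ≡ true → ∀ i j → adj G i j ≡ true → f i ≢ f j
properℕ⁻ G {f} e i j a q with imp-or (all⁻ _ (all⁻ _ e i) j) a
... | r rewrite ≡ᵇ-complete q = contradiction r λ ()

-- The chromatic polynomial, evaluated at k.
P : ∀ {n} → Graph n → ℕ → ℕ
P {n} G k = sumFun n {k} (λ c → ⟦ properᵇ G c ⟧)

S≡canonicalSum : ∀ {n} (G : Graph n) t → S G t ≡ canonicalSum n 0 t (λ f → ⟦ properℕ G f ⟧)
S≡canonicalSum {n} G t = begin
  S G t
    ≡⟨ countTrue-allFuns n {t} _ ⟩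
  sumFun n {t} (λ c → ⟦ properᵇ G c ∧ (surjᵇ c ∧ canonicalᵇ c) ⟧)
    ≡⟨ sumFun-cong n (λ c → trans (⟦⟧-∧ (properᵇ G c) _) (cong (λ b → ⟦ properᵇ G c ⟧ * ⟦ b ⟧) (surj-canonical c))) ⟩
  sumFun n {t} (λ c → ⟦ properℕ G (toℕ ∘ c) ⟧ * ⟦ introduces n 0 t (toℕ ∘ c) ⟧)
    ≡⟨ sumFun-introduces n t 0 t _ (properℕ-ext G) refl ⟩
  canonicalSum n 0 t (λ f → ⟦ properℕ G f ⟧) ∎

-- Uniqueness of falling factorial coefficients

opaque

  ∑≤ : ℕ → (ℕ → ℕ) → ℕ
  ∑≤ n f = sum {suc n} (f ∘ toℕ)

  ∑≤-def : ∀ n f → ∑≤ n f ≡ sum {suc n} (f ∘ toℕ)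
  ∑≤-def n f = refl

  ∑≤-last : ∀ N (h : ℕ → ℕ) → ∑≤ (suc N) h ≡ ∑≤ N h + h (suc N)
  ∑≤-last zero    h = trans (cong (h 0 +_) (+-identityʳ (h 1))) (cong (_+ h 1) (sym (+-identityʳ (h 0))))
  ∑≤-last (suc N) h = trans (cong (h 0 +_) (∑≤-last N (h ∘ suc))) (sym (+-assoc (h 0) _ _))

  ∑≤-cong : ∀ N {f g : ℕ → ℕ} → f ≗ g → ∑≤ N f ≡ ∑≤ N g
  ∑≤-cong N h = sum-cong-≗ {suc N} (h ∘ toℕ)

  ∑≤-+ : ∀ N (f g : ℕ → ℕ) → ∑≤ N (λ k → f k + g k) ≡ ∑≤ N f + ∑≤ N g
  ∑≤-+ N f g = ∑-distrib-+ {suc N} (f ∘ toℕ) (g ∘ toℕ)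

  ∑≤-* : ∀ N x (f : ℕ → ℕ) → ∑≤ N (λ k → x * f k) ≡ x * ∑≤ N f
  ∑≤-* N x f = sym (*-distribˡ-sum {suc N} x (f ∘ toℕ))

  ∑≤-sumFrom1 : ∀ N f → ∑≤ N f ≡ f 0 + sumFrom1 N f
  ∑≤-sumFrom1 zero    f = refl
  ∑≤-sumFrom1 (suc N) f = trans (∑≤-last N f) (trans (cong (_+ f (suc N)) (∑≤-sumFrom1 N f)) (+-assoc (f 0) _ _))

  ∑≤-suc : ∀ N f → ∑≤ (suc N) f ≡ f 0 + ∑≤ N (f ∘ suc)
  ∑≤-suc N f = refl

  ∑≤-positive : ∀ N f {k} → k ≤ N → 1 ≤ f k → 1 ≤ ∑≤ N f
  ∑≤-positive N f k≤N l = sum-positive {suc N} (f ∘ toℕ) (fromℕ< (s≤s k≤N))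
    (subst (λ x → 1 ≤ f x) (sym (toℕ-fromℕ< (s≤s k≤N))) l)

  ∑≤-cauchy-schwarz : ∀ N f →
    ∑≤ N (λ k → k * f k) * ∑≤ N (λ k → k * f k) ≤ ∑≤ N f * ∑≤ N (λ k → k * (k * f k))
  ∑≤-cauchy-schwarz N f = cauchy-schwarz {suc N} (f ∘ toℕ) toℕ

P-expansion : ∀ {n} (G : Graph n) k → P G k ≡ ∑≤ n (λ t → fall k t * S G t)
P-expansion {n} G k = begin
  P G k
    ≡⟨ sumFun-canonical n k 0 k n _ (properℕ-blind G) refl ≤-refl ⟩
  sum {suc n} (λ t → fall k (toℕ t) * canonicalSum n 0 (toℕ t) (λ f → ⟦ properℕ G f ⟧))
    ≡⟨ sum-cong-≗ {suc n} (λ t → cong (fall k (toℕ t) *_) (sym (S≡canonicalSum G (toℕ t)))) ⟩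
  sum {suc n} (λ t → fall k (toℕ t) * S G (toℕ t))
    ≡⟨ ∑≤-def n (λ t → fall k t * S G t) ⟨
  ∑≤ n (λ t → fall k t * S G t) ∎

-- At r = 0 only the term t = 0 survives, so the coefficients at 0 agree. At r + 1 every other term
-- contains the factor r + 1; cancelling it leaves the hypothesis for the shifted sequences, with
-- one term fewer.
fall-coefficients-unique : ∀ N (f g : ℕ → ℕ) →
  (∀ r → ∑≤ N (λ t → fall r t * f t) ≡ ∑≤ N (λ t → fall r t * g t)) →
  ∀ t → t ≤ N → f t ≡ g t
fall-coefficients-unique N f g h = go
  where
  at-zero : ∀ N (f : ℕ → ℕ) → ∑≤ N (λ t → fall 0 t * f t) ≡ f 0
  at-zero zero    f = trans (∑≤-sumFrom1 0 _) (trans (+-identityʳ (f 0 + 0)) (+-identityʳ (f 0)))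
  at-zero (suc N) f = trans (∑≤-last N _) (trans (+-identityʳ _) (at-zero N f))
  f0≡g0 : f 0 ≡ g 0
  f0≡g0 = trans (sym (at-zero N f)) (trans (h 0) (at-zero N g))
  go : ∀ t → t ≤ N → f t ≡ g t
  go zero    _ = f0≡g0
  go (suc t) (s≤s {n = N′} t≤N) = fall-coefficients-unique N′ (f ∘ suc) (g ∘ suc) h′ t t≤N
    where
    pull : ∀ (f : ℕ → ℕ) r → ∑≤ (suc N′) (λ t → fall (suc r) t * f t) ≡ f 0 + suc r * ∑≤ N′ (λ t → fall r t * f (suc t))
    pull f r = trans (∑≤-suc N′ (λ t → fall (suc r) t * f t)) (cong₂ _+_ (+-identityʳ (f 0)) (trans
      (∑≤-cong N′ λ t → *-assoc (suc r) (fall r t) (f (suc t)))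
      (∑≤-* N′ (suc r) (λ t → fall r t * f (suc t)))))
    h′ : ∀ r → ∑≤ N′ (λ t → fall r t * f (suc t)) ≡ ∑≤ N′ (λ t → fall r t * g (suc t))
    h′ r = *-cancelˡ-≡ _ _ (suc r) (+-cancelˡ-≡ (f 0) _ _ (begin
      f 0 + suc r * ∑≤ N′ (λ t → fall r t * f (suc t)) ≡⟨ pull f r ⟨
      ∑≤ (suc N′) (λ t → fall (suc r) t * f t)         ≡⟨ h (suc r) ⟩
      ∑≤ (suc N′) (λ t → fall (suc r) t * g t)         ≡⟨ pull g r ⟩
      g 0 + suc r * ∑≤ N′ (λ t → fall r t * g (suc t)) ≡⟨ cong (_+ _) (sym f0≡g0) ⟩
      f 0 + suc r * ∑≤ N′ (λ t → fall r t * g (suc t)) ∎))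

S-determined : ∀ {n} (G : Graph n) (s : ℕ → ℕ) → (∀ k → P G k ≡ ∑≤ n (λ t → fall k t * s t)) →
  ∀ t → t ≤ n → S G t ≡ s t
S-determined {n} G s h = fall-coefficients-unique n (S G) s (λ k → trans (sym (P-expansion G k)) (h k))

-- Inserting and relabeling vertices

sum-swap : ∀ n {k} j (H : Fin j → (Fin n → Fin k) → ℕ) →
  sum {j} (λ a → sumFun n (H a)) ≡ sumFun n (λ c → sum {j} (λ a → H a c))
sum-swap zero    j H = refl
sum-swap (suc n) {k} j H =
  trans (∑-comm {j} {k} (λ a b → sumFun n (λ c → H a (cons b c))))
        (sum-cong-≗ {k} λ b → sum-swap n j (λ a c → H a (cons b c)))

sumFun-insertAt : ∀ n {k} (v : Fin (suc n)) (Φ : (Fin (suc n) → Fin k) → ℕ) → Ext Φ →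
  sumFun (suc n) Φ ≡ sum {k} (λ a → sumFun n (λ c → Φ (insertAt c v a)))
sumFun-insertAt n {k} zero Φ e =
  sum-cong-≗ {k} λ a → sumFun-cong n λ c → e λ { zero → refl ; (suc i) → refl }
sumFun-insertAt (suc n) {k} (suc v) Φ e = begin
  sum {k} (λ b → sumFun (suc n) (λ c → Φ (cons b c)))
    ≡⟨ sum-cong-≗ {k} (λ b → sumFun-insertAt n v (λ c → Φ (cons b c)) (e ∘ cons-cong b)) ⟩
  sum {k} (λ b → sum {k} (λ a → sumFun n (λ c → Φ (cons b (insertAt c v a)))))
    ≡⟨ ∑-comm {k} {k} (λ b a → sumFun n (λ c → Φ (cons b (insertAt c v a)))) ⟩
  sum {k} (λ a → sum {k} (λ b → sumFun n (λ c → Φ (cons b (insertAt c v a)))))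
    ≡⟨ sum-cong-≗ {k} (λ a → sum-cong-≗ {k} λ b → sumFun-cong n λ c → e λ { zero → refl ; (suc i) → refl }) ⟩
  sum {k} (λ a → sumFun (suc n) (λ c → Φ (insertAt c (suc v) a))) ∎

-- Since π sends v to 0, relabeling puts color `a` at v, and the other vertices follow π with v
-- deleted. This lets `sumFun-relabel` recurse.
remove-position : ∀ {n k} (π : Permutation′ (suc n)) (a : Fin k) (c : Fin n → Fin k) →
  let v = π ⟨$⟩ˡ zero in
  (cons a c ∘ (π ⟨$⟩ʳ_)) ≗ insertAt (c ∘ (Perm.remove v π ⟨$⟩ʳ_)) v a
remove-position π a c x with x Finₚ.≟ (π ⟨$⟩ˡ zero)
... | yes refl = trans (cong (cons a c) (Perm.inverseʳ π)) (sym (insertAt-lookup (c ∘ (Perm.remove (π ⟨$⟩ˡ zero) π ⟨$⟩ʳ_)) (π ⟨$⟩ˡ zero) a))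
... | no  x≢v  = begin
  cons a c (π ⟨$⟩ʳ x)                            ≡⟨ cong (cons a c ∘ (π ⟨$⟩ʳ_)) x≡ ⟨
  cons a c (π ⟨$⟩ʳ punchIn v y)                  ≡⟨ cong (cons a c) (Perm.punchIn-permute′ π zero y) ⟩
  c (Perm.remove v π ⟨$⟩ʳ y)                     ≡⟨ insertAt-punchIn _ v a y ⟨
  insertAt (c ∘ (Perm.remove v π ⟨$⟩ʳ_)) v a (punchIn v y) ≡⟨ cong (insertAt (c ∘ (Perm.remove v π ⟨$⟩ʳ_)) v a) x≡ ⟩
  insertAt (c ∘ (Perm.remove v π ⟨$⟩ʳ_)) v a x   ∎
  where
  v = π ⟨$⟩ˡ zero
  y = Fin.punchOut {i = v} {j = x} (x≢v ∘ sym)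
  x≡ : punchIn v y ≡ x
  x≡ = Finₚ.punchIn-punchOut (x≢v ∘ sym)

sumFun-relabel : ∀ n {k} (π : Permutation′ n) (Φ : (Fin n → Fin k) → ℕ) → Ext Φ →
  sumFun n (λ c → Φ (c ∘ (π ⟨$⟩ʳ_))) ≡ sumFun n Φ
sumFun-relabel zero    π Φ e = e λ ()
sumFun-relabel (suc n) {k} π Φ e = begin
  sum {k} (λ a → sumFun n (λ c → Φ (cons a c ∘ (π ⟨$⟩ʳ_))))
    ≡⟨ sum-cong-≗ {k} (λ a → sumFun-cong n λ c → e (remove-position π a c)) ⟩
  sum {k} (λ a → sumFun n (λ c → Φ (insertAt (c ∘ (Perm.remove v π ⟨$⟩ʳ_)) v a)))
    ≡⟨ sum-cong-≗ {k} (λ a → sumFun-relabel n (Perm.remove v π) (λ c → Φ (insertAt c v a)) (λ h → e (insertAt-cong v h))) ⟩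
  sum {k} (λ a → sumFun n (λ c → Φ (insertAt c v a)))
    ≡⟨ sumFun-insertAt n v Φ e ⟨
  sumFun (suc n) Φ ∎
  where
  v = π ⟨$⟩ˡ zero
  insertAt-cong : ∀ {n k} (v : Fin (suc n)) {a : Fin k} {f g : Fin n → Fin k} → f ≗ g → insertAt f v a ≗ insertAt g v a
  insertAt-cong zero    h zero    = refl
  insertAt-cong zero    h (suc i) = h i
  insertAt-cong {suc n} (suc v) h zero    = h zero
  insertAt-cong {suc n} (suc v) h (suc i) = insertAt-cong v (h ∘ suc) i

P-iso : ∀ {n} {G H : Graph n} → G ≅ H → ∀ k → P G k ≡ P H k
P-iso {n} {G} {H} (π , h) k = sym (begin
  sumFun n {k} (λ c → ⟦ properᵇ H c ⟧)
    ≡⟨ sumFun-cong n (λ c → cong ⟦_⟧ (bool-ext (pull c) (push c))) ⟩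
  sumFun n {k} (λ c → ⟦ properᵇ G (c ∘ (π ⟨$⟩ʳ_)) ⟧)
    ≡⟨ sumFun-relabel n π (λ c → ⟦ properᵇ G c ⟧) (λ q → properℕ-ext G (cong toℕ ∘ q)) ⟩
  sumFun n {k} (λ c → ⟦ properᵇ G c ⟧) ∎)
  where
  pull : ∀ (c : Fin n → Fin k) → properᵇ H c ≡ true → properᵇ G (c ∘ (π ⟨$⟩ʳ_)) ≡ true
  pull c e = properℕ⁺ G λ i j a → properℕ⁻ H {toℕ ∘ c} e (π ⟨$⟩ʳ i) (π ⟨$⟩ʳ j) (trans (h i j) a)
  push : ∀ (c : Fin n → Fin k) → properᵇ G (c ∘ (π ⟨$⟩ʳ_)) ≡ true → properᵇ H c ≡ true
  push c e = properℕ⁺ H λ i j a q → properℕ⁻ G {toℕ ∘ c ∘ (π ⟨$⟩ʳ_)} e (π ⟨$⟩ˡ i) (π ⟨$⟩ˡ j)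
    (trans (sym (h _ _)) (trans (cong₂ (adj H) (Perm.inverseʳ π) (Perm.inverseʳ π)) a))
    (trans (cong (toℕ ∘ c) (Perm.inverseʳ π)) (trans q (sym (cong (toℕ ∘ c) (Perm.inverseʳ π)))))

-- Perfect elimination orderings

≢⇒==false : ∀ {n} {i j : Fin n} → i ≢ j → (i == j) ≡ false
≢⇒==false h = ≡ᵇ-false (h ∘ toℕ-injective)

==-refl : ∀ {n} (i : Fin n) → (i == i) ≡ true
==-refl i = ≡ᵇ-refl (toℕ i)

sum-mono : ∀ {n} {f g : Fin n → ℕ} → (∀ i → f i ≤ g i) → sum f ≤ sum g
sum-mono {zero}  h = z≤n
sum-mono {suc n} h = +-mono-≤ (h zero) (sum-mono (h ∘ suc))

sum-== : ∀ {n} (x : Fin n) → sum {n} (λ a → ⟦ x == a ⟧) ≡ 1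
sum-== {suc n} zero    = cong suc (sum-zero {n} (λ _ → 0) (λ _ → refl))
sum-== {suc n} (suc x) = sum-== x

-- Applied with `b i` saying that neighbor i has a given color: the color is either free, which the
-- first summand counts, or taken by exactly one neighbor.
sum-at-most-one : ∀ {n} (b : Fin n → Bool) → (∀ i j → b i ≡ true → b j ≡ true → i ≡ j) →
  ⟦ all (not ∘ b) (allFin n) ⟧ + sum (⟦_⟧ ∘ b) ≡ 1
sum-at-most-one {n} b h with all (not ∘ b) (allFin n) in eq
... | true  = cong suc (sum-zero _ λ i → cong ⟦_⟧ (not-true (all⁻ (not ∘ b) eq i)))
  where
  not-true : ∀ {x} → not x ≡ true → x ≡ false
  not-true {false} _ = refl
... | false = trans (sum-cong-≗ (λ j → cong ⟦_⟧ (bool-ext (λ e → subst (λ x → (i == x) ≡ true) (h i j bi e) (==-refl i))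
                                                        (λ e → subst (λ x → b x ≡ true) (toℕ-injective (≡ᵇ-sound e)) bi))))
                    (sum-== i)
  where
  search : ∀ m (c : Fin m → Bool) → all (not ∘ c) (allFin m) ≡ false → ∃ λ i → c i ≡ true
  search m c e with any c (allFin m) in q
  ... | true  = any⁻ c q
  ... | false = contradiction (trans (sym e) (all⁺ (not ∘ c) λ i → cong not (≢true⇒false (λ ci → contradiction (trans (sym q) (any⁺ c i ci)) λ ())))) λ ()
  i = proj₁ (search n b eq)
  bi = proj₂ (search n b eq)

sumFun-distrib : ∀ n {k} x (Φ : (Fin n → Fin k) → ℕ) → sumFun n (λ c → x * Φ c) ≡ x * sumFun n Φ
sumFun-distrib zero    x Φ = refl
sumFun-distrib (suc n) {k} x Φ =
  trans (sum-cong-≗ {k} λ a → sumFun-distrib n x (Φ ∘ cons a)) (sym (*-distribˡ-sum {k} x _))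

sumFun-positive⁺ : ∀ n {k} (Φ : (Fin n → Fin k) → ℕ) → Ext Φ → ∀ c → 1 ≤ Φ c → 1 ≤ sumFun n Φ
sumFun-positive⁺ zero    Φ e c l = subst (1 ≤_) (e λ ()) l
sumFun-positive⁺ (suc n) Φ e c l = sum-positive _ (c zero)
  (sumFun-positive⁺ n (Φ ∘ cons (c zero)) (e ∘ cons-cong (c zero)) (c ∘ suc)
    (subst (1 ≤_) (e λ { zero → refl ; (suc i) → refl }) l))

sumFun-positive⁻ : ∀ n {k} (Φ : (Fin n → Fin k) → ℕ) → 1 ≤ sumFun n Φ → ∃ λ c → 1 ≤ Φ c
sumFun-positive⁻ zero    Φ l = _ , l
sumFun-positive⁻ (suc n) {k} Φ l =
  let a , l₁ = sum-positive⁻ {k} _ l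
      c , l₂ = sumFun-positive⁻ n _ l₁
  in cons a c , l₂

⟦⟧-positive⁻ : ∀ {b} → 1 ≤ ⟦ b ⟧ → b ≡ true
⟦⟧-positive⁻ {true} _ = refl

⟦⟧-positive⁺ : ∀ {b} → b ≡ true → 1 ≤ ⟦ b ⟧
⟦⟧-positive⁺ refl = ≤-refl

P-positive⁺ : ∀ {n k} (G : Graph n) (c : Fin n → Fin k) → Proper G c → 1 ≤ P G k
P-positive⁺ {n} G c pc = sumFun-positive⁺ n (λ c → ⟦ properᵇ G c ⟧) (λ h → properℕ-ext G (cong toℕ ∘ h)) c
  (⟦⟧-positive⁺ (properℕ⁺ G {toℕ ∘ c} λ i j a → pc i j a ∘ toℕ-injective))

P-positive⁻ : ∀ {n k} (G : Graph n) → 1 ≤ P G k → Σ (Fin n → Fin k) (Proper G)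
P-positive⁻ {n} G l =
  let c , l′ = sumFun-positive⁻ n _ l
  in c , λ i j a → properℕ⁻ G {toℕ ∘ c} (⟦⟧-positive⁻ l′) i j a ∘ cong toℕ

remove : ∀ {n} → Graph (suc n) → Fin (suc n) → Graph n
remove G v = record
  { adj    = λ i j → adj G (punchIn v i) (punchIn v j)
  ; sym    = λ i j → Graph.sym G (punchIn v i) (punchIn v j)
  ; irrefl = λ i → Graph.irrefl G (punchIn v i) }

data Around {n} (v : Fin (suc n)) : Fin (suc n) → Set where
  here  : Around v v
  there : ∀ y → Around v (punchIn v y)

around : ∀ {n} (v x : Fin (suc n)) → Around v x
around v x with x Finₚ.≟ v
... | yes refl = here
... | no  x≢v  = subst (Around v) (Finₚ.punchIn-punchOut (x≢v ∘ sym)) (there _)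

Simplicial : ∀ {n} → Graph n → Fin n → Set
Simplicial G v = ∀ u w → adj G v u ≡ true → adj G v w ≡ true → u ≢ w → adj G u w ≡ true

degree-sum : ∀ {n} (G : Graph n) v → degree G v ≡ sum (λ i → ⟦ adj G v i ⟧)
degree-sum G v = countTrue-tabulate (adj G v) id

module _ {n} (G : Graph (suc n)) (v : Fin (suc n)) where

  nbr : Fin n → Bool
  nbr i = adj G v (punchIn v i)

  degree-nbr : degree G v ≡ sum (⟦_⟧ ∘ nbr)
  degree-nbr = trans (degree-sum G v) (trans (sum-remove {i = v} (λ i → ⟦ adj G v i ⟧))
    (cong (λ b → ⟦ b ⟧ + sum (⟦_⟧ ∘ nbr)) (Graph.irrefl G v)))

  degree-remove : ∀ w → degree G (punchIn v w) ≡ ⟦ nbr w ⟧ + degree (remove G v) w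
  degree-remove w = begin
    degree G (punchIn v w)                       ≡⟨ degree-sum G (punchIn v w) ⟩
    sum (λ i → ⟦ adj G (punchIn v w) i ⟧)        ≡⟨ sum-remove {i = v} (λ i → ⟦ adj G (punchIn v w) i ⟧) ⟩
    ⟦ adj G (punchIn v w) v ⟧ + sum (λ i → ⟦ adj (remove G v) w i ⟧)
      ≡⟨ cong₂ (λ b d → ⟦ b ⟧ + d) (Graph.sym G (punchIn v w) v) (sym (degree-sum (remove G v) w)) ⟩
    ⟦ nbr w ⟧ + degree (remove G v) w            ∎

  free : ∀ {k} → (Fin n → Fin k) → Fin k → Bool
  free c a = all (λ i → not (nbr i ∧ (c i == a))) (allFin n)

  proper-insertAt : ∀ {k} (c : Fin n → Fin k) a →
    properᵇ G (insertAt c v a) ≡ properᵇ (remove G v) c ∧ free c a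
  proper-insertAt c a = bool-ext split join
    where
    c′ = insertAt c v a
    at-v : c′ v ≡ a
    at-v = insertAt-lookup c v a
    off-v : ∀ i → c′ (punchIn v i) ≡ c i
    off-v i = insertAt-punchIn c v a i
    split : properᵇ G c′ ≡ true → properᵇ (remove G v) c ∧ free c a ≡ true
    split e = and-true
      (properℕ⁺ (remove G v) {toℕ ∘ c} λ i j r q → properℕ⁻ G {toℕ ∘ c′} e _ _ r
        (trans (cong toℕ (off-v i)) (trans q (sym (cong toℕ (off-v j))))))
      (all⁺ _ λ i → cong not (≢true⇒false λ t →
        properℕ⁻ G {toℕ ∘ c′} e v (punchIn v i) (proj₁ (∧-true t))
          (trans (cong toℕ at-v) (trans (sym (≡ᵇ-sound (proj₂ (∧-true {nbr i} t)))) (sym (cong toℕ (off-v i)))))))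
    join : properᵇ (remove G v) c ∧ free c a ≡ true → properᵇ G c′ ≡ true
    join e = properℕ⁺ G {toℕ ∘ c′} λ i j → go (around v i) (around v j)
      where
      clash : ∀ i → nbr i ≡ true → toℕ (c i) ≢ toℕ a
      clash i r q = contradiction
        (all⁻ (λ i → not (nbr i ∧ (c i == a))) (proj₂ (∧-true {properᵇ (remove G v) c} e)) i)
        (λ h → contradiction (trans (sym h) (cong not (and-true r (≡ᵇ-complete q)))) λ ())
      go : ∀ {i j} → Around v i → Around v j → adj G i j ≡ true → toℕ (c′ i) ≢ toℕ (c′ j)
      go here here r = contradiction (trans (sym r) (Graph.irrefl G v)) λ ()
      go here (there y) r q = clash y r (trans (sym (cong toℕ (off-v y))) (trans (sym q) (cong toℕ at-v)))
      go (there x) here r q = clash x (trans (Graph.sym G v (punchIn v x)) r)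
        (trans (sym (cong toℕ (off-v x))) (trans q (cong toℕ at-v)))
      go (there x) (there y) r q = properℕ⁻ (remove G v) {toℕ ∘ c} (proj₁ (∧-true e)) x y r
        (trans (sym (cong toℕ (off-v x))) (trans q (cong toℕ (off-v y))))

  module _ (simp : Simplicial G v) where

    -- The neighbors of v are pairwise adjacent, so they have distinct colors and block exactly
    -- `degree G v` of the k. The additive form also yields `degree G v ≤ k`.
    free-count : ∀ {k} (c : Fin n → Fin k) → properᵇ (remove G v) c ≡ true →
      sum {k} (λ a → ⟦ free c a ⟧) + degree G v ≡ k
    free-count {k} c pc = begin
      sum {k} (λ a → ⟦ free c a ⟧) + degree G v
        ≡⟨ cong (sum {k} (λ a → ⟦ free c a ⟧) +_) (sym colors-of-nbrs) ⟩
      sum {k} (λ a → ⟦ free c a ⟧) + sum {k} (λ a → sum (λ i → ⟦ nbr i ∧ (c i == a) ⟧))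
        ≡⟨ ∑-distrib-+ {k} (λ a → ⟦ free c a ⟧) (λ a → sum (λ i → ⟦ nbr i ∧ (c i == a) ⟧)) ⟨
      sum {k} (λ a → ⟦ free c a ⟧ + sum (λ i → ⟦ nbr i ∧ (c i == a) ⟧))
        ≡⟨ sum-cong-≗ {k} (λ a → sum-at-most-one _ (injective a)) ⟩
      sum {k} (λ _ → 1)
        ≡⟨ trans (sum-const k 1) (*-identityʳ k) ⟩
      k ∎
      where
      injective : ∀ a i j → nbr i ∧ (c i == a) ≡ true → nbr j ∧ (c j == a) ≡ true → i ≡ j
      injective a i j p q with i Finₚ.≟ j
      ... | yes i≡j = i≡j
      ... | no  i≢j = contradiction
        (trans (≡ᵇ-sound (proj₂ (∧-true {nbr i} p))) (sym (≡ᵇ-sound (proj₂ (∧-true {nbr j} q)))))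
        (properℕ⁻ (remove G v) {toℕ ∘ c} pc i j
          (simp _ _ (proj₁ (∧-true p)) (proj₁ (∧-true q)) (i≢j ∘ Finₚ.punchIn-injective v i j)))
      colors-of-nbrs : sum {k} (λ a → sum (λ i → ⟦ nbr i ∧ (c i == a) ⟧)) ≡ degree G v
      colors-of-nbrs = begin
        sum {k} (λ a → sum (λ i → ⟦ nbr i ∧ (c i == a) ⟧))
          ≡⟨ ∑-comm {k} {n} (λ a i → ⟦ nbr i ∧ (c i == a) ⟧) ⟩
        sum (λ i → sum {k} (λ a → ⟦ nbr i ∧ (c i == a) ⟧))
          ≡⟨ sum-cong-≗ (λ i → begin
               sum {k} (λ a → ⟦ nbr i ∧ (c i == a) ⟧)  ≡⟨ sum-cong-≗ {k} (λ a → ⟦⟧-∧ (nbr i) (c i == a)) ⟩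
               sum {k} (λ a → ⟦ nbr i ⟧ * ⟦ c i == a ⟧) ≡⟨ *-distribˡ-sum {k} ⟦ nbr i ⟧ (λ a → ⟦ c i == a ⟧) ⟨
               ⟦ nbr i ⟧ * sum {k} (λ a → ⟦ c i == a ⟧) ≡⟨ cong (⟦ nbr i ⟧ *_) (sum-== (c i)) ⟩
               ⟦ nbr i ⟧ * 1                            ≡⟨ *-identityʳ _ ⟩
               ⟦ nbr i ⟧                                ∎) ⟩
        sum (⟦_⟧ ∘ nbr)
          ≡⟨ degree-nbr ⟨
        degree G v ∎

    -- Each proper coloring of the rest extends in `k ∸ degree G v` ways. Truncation is harmless: if
    -- the degree exceeds k, the rest has no proper coloring with k colors and both sides vanish.
    P-simplicial : ∀ k → P G k ≡ P (remove G v) k * (k ∸ degree G v)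
    P-simplicial k = begin
      P G k
        ≡⟨ sumFun-insertAt n {k} v (λ c → ⟦ properᵇ G c ⟧) (λ h → properℕ-ext G (cong toℕ ∘ h)) ⟩
      sum {k} (λ a → sumFun n (λ c → ⟦ properᵇ G (insertAt c v a) ⟧))
        ≡⟨ sum-swap n k (λ a c → ⟦ properᵇ G (insertAt c v a) ⟧) ⟩
      sumFun n (λ c → sum {k} (λ a → ⟦ properᵇ G (insertAt c v a) ⟧))
        ≡⟨ sumFun-cong n per-coloring ⟩
      sumFun n (λ c → (k ∸ degree G v) * ⟦ properᵇ (remove G v) c ⟧)
        ≡⟨ sumFun-distrib n (k ∸ degree G v) (λ c → ⟦ properᵇ (remove G v) c ⟧) ⟩
      (k ∸ degree G v) * P (remove G v) k
        ≡⟨ *-comm (k ∸ degree G v) _ ⟩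
      P (remove G v) k * (k ∸ degree G v) ∎
      where
      per-coloring : ∀ (c : Fin n → Fin k) →
        sum {k} (λ a → ⟦ properᵇ G (insertAt c v a) ⟧) ≡ (k ∸ degree G v) * ⟦ properᵇ (remove G v) c ⟧
      per-coloring c = trans (sum-cong-≗ {k} (λ a → cong ⟦_⟧ (proper-insertAt c a))) (by-case _ refl)
        where
        by-case : ∀ b → properᵇ (remove G v) c ≡ b →
          sum {k} (λ a → ⟦ properᵇ (remove G v) c ∧ free c a ⟧) ≡ (k ∸ degree G v) * ⟦ properᵇ (remove G v) c ⟧
        by-case true pc rewrite pc = trans
          (sym (trans (cong (_∸ degree G v) (sym (free-count c pc))) (m+n∸n≡m (sum {k} (λ a → ⟦ free c a ⟧)) (degree G v))))
          (sym (*-identityʳ _))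
        by-case false pc rewrite pc = trans (sum-zero {k} (λ _ → 0) (λ _ → refl)) (sym (*-zeroʳ (k ∸ degree G v)))

    simplicial-degree≤ : ∀ k → 1 ≤ P (remove G v) k → degree G v ≤ k
    simplicial-degree≤ k l =
      let c , l′ = sumFun-positive⁻ n _ l
      in subst (degree G v ≤_) (free-count c (⟦⟧-positive⁻ l′)) (m≤n+m (degree G v) (sum {k} (λ a → ⟦ free c a ⟧)))

-- The degrees met along a perfect elimination ordering; the last entry
-- belongs to the vertex eliminated first.
data Elim : ∀ {n} → Graph n → List ℕ → Set where
  done : ∀ {G : Graph 0} → Elim G []
  peel : ∀ {n} {G : Graph (suc n)} v {D} → Simplicial G v → Elim (remove G v) D → Elim G (D ∷ʳ degree G v)

triangulated⇒elim : ∀ {n} (G : Graph n) → Triangulated G → ∃ (Elim G)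
triangulated⇒elim {zero}  G tri = [] , done
triangulated⇒elim {suc n} G tri =
  let v , _ , s = tri (λ _ → true) (zero , refl)
      D , e     = triangulated⇒elim (remove G v) (hereditary v)
  in _ , peel v (λ u w a b → s u w refl refl a b) e
  where
  hereditary : ∀ v → Triangulated (remove G v)
  hereditary v U (w , Uw) = go (tri U′ (punchIn v w , trans (insertAt-punchIn U v false w) Uw))
    where
    -- An induced subgraph of `remove G v` is an induced subgraph of G that avoids v.
    U′ = insertAt U v false
    go : Σ (Fin (suc n)) (λ x → (U′ x ≡ true) × SimplicialIn G U′ x) →
         Σ (Fin n) λ x → (U x ≡ true) × SimplicialIn (remove G v) U x
    go (x , Ux , s) with around v x
    ... | here    = contradiction (trans (sym Ux) (insertAt-lookup U v false)) λ ()
    ... | there y = y , trans (sym (insertAt-punchIn U v false y)) Ux ,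
      λ u w Uu Uw a b u≢w → s (punchIn v u) (punchIn v w)
        (trans (insertAt-punchIn U v false u) Uu) (trans (insertAt-punchIn U v false w) Uw)
        a b (u≢w ∘ Finₚ.punchIn-injective v u w)

fallingProduct : ℕ → List ℕ → ℕ
fallingProduct k L = product (map (k ∸_) L)

fallingProduct-∷ʳ : ∀ k L d → fallingProduct k (L ∷ʳ d) ≡ fallingProduct k L * (k ∸ d)
fallingProduct-∷ʳ k []      d = *-comm (k ∸ d) 1
fallingProduct-∷ʳ k (x ∷ L) d =
  trans (cong ((k ∸ x) *_) (fallingProduct-∷ʳ k L d)) (sym (*-assoc (k ∸ x) _ (k ∸ d)))

P-elim : ∀ {n} {G : Graph n} {L} → Elim G L → ∀ k → P G k ≡ fallingProduct k L
P-elim done           k = refl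
P-elim {G = G} (peel v {D} s e) k = begin
  P G k                                ≡⟨ P-simplicial G v s k ⟩
  P (remove G v) k * (k ∸ degree G v)  ≡⟨ cong (_* (k ∸ degree G v)) (P-elim e k) ⟩
  fallingProduct k D * (k ∸ degree G v) ≡⟨ fallingProduct-∷ʳ k D (degree G v) ⟨
  fallingProduct k (D ∷ʳ degree G v)   ∎

elim-length : ∀ {n} {G : Graph n} {L} → Elim G L → length L ≡ n
elim-length done = refl
elim-length {G = G} (peel v {D} s e) =
  trans (length-++ D) (trans (+-comm (length D) 1) (cong suc (elim-length e)))

-- Number of colors needed after the vertices in the list, starting from m.
colors : ℕ → List ℕ → ℕ
colors m []      = m
colors m (d ∷ L) = colors (m ⊔ suc d) L

colors-∷ʳ : ∀ m L d → colors m (L ∷ʳ d) ≡ colors m L ⊔ suc d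
colors-∷ʳ m []      d = refl
colors-∷ʳ m (x ∷ L) d = colors-∷ʳ (m ⊔ suc x) L d

colors-≥ : ∀ m L → m ≤ colors m L
colors-≥ m []      = ≤-refl
colors-≥ m (d ∷ L) = ≤-trans (m≤m⊔n m (suc d)) (colors-≥ (m ⊔ suc d) L)

*-positive⁻ : ∀ a b → 1 ≤ a * b → 1 ≤ a × 1 ≤ b
*-positive⁻ (suc a) zero    l = contradiction (subst (1 ≤_) (*-zeroʳ a) l) λ ()
*-positive⁻ (suc a) (suc b) l = s≤s z≤n , s≤s z≤n

colors-least : ∀ m k L → m ≤ k → 1 ≤ fallingProduct k L → colors m L ≤ k
colors-least m k []      m≤k l = m≤k
colors-least m k (d ∷ L) m≤k l =
  let l₁ , l₂ = *-positive⁻ (k ∸ d) _ l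
  in colors-least (m ⊔ suc d) k L (⊔-lub m≤k (m<n∸o⇒o+m<n′ l₁)) l₂
  where
  m<n∸o⇒o+m<n′ : 1 ≤ k ∸ d → suc d ≤ k
  m<n∸o⇒o+m<n′ h = m∸n≢0⇒n<m (λ e → contradiction (subst (1 ≤_) e h) λ ())

colors-suffice : ∀ m k L → colors m L ≤ k → 1 ≤ fallingProduct k L
colors-suffice m k []      l = ≤-refl
colors-suffice m k (d ∷ L) l = *-mono-≤
  (m<n⇒0<n∸m (≤-trans (m≤n⊔m m (suc d)) (≤-trans (colors-≥ (m ⊔ suc d) L) l)))
  (colors-suffice (m ⊔ suc d) k L l)

-- An entry is bounded by the number of colors forced before it. The coefficients expanded so far
-- vanish below that number, so `times d` is faithful. The number grows only by an entry equal to
-- it, hence by one: from m = 0 the entries include every color count below the final one.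
data Valid : ℕ → List ℕ → Set where
  []  : ∀ {m} → Valid m []
  _∷_ : ∀ {m d L} → d ≤ m → Valid (m ⊔ suc d) L → Valid m (d ∷ L)

valid-∷ʳ : ∀ {m L d} → Valid m L → d ≤ colors m L → Valid m (L ∷ʳ d)
valid-∷ʳ []       h = h ∷ []
valid-∷ʳ (l ∷ va) h = l ∷ valid-∷ʳ va h

-- At k = `colors 0 D` the product for D is positive, so the rest is k-colorable and the clique of
-- neighbors of the peeled vertex has at most k members.
elim-valid : ∀ {n} {G : Graph n} {L} → Elim G L → Valid 0 L
elim-valid done = []
elim-valid {G = G} (peel v {D} s e) = valid-∷ʳ (elim-valid e)
  (simplicial-degree≤ G v s (colors 0 D)
    (subst (1 ≤_) (sym (P-elim e (colors 0 D))) (colors-suffice 0 (colors 0 D) D ≤-refl)))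

elim-chromatic : ∀ {n} {G : Graph n} {L} → Elim G L → ∀ χ → IsChromaticNumber G χ → χ ≡ colors 0 L
elim-chromatic {G = G} {L} e χ ((c , pc) , least) = ≤-antisym
  (let c′ , pc′ = P-positive⁻ G (subst (1 ≤_) (sym (P-elim e _)) (colors-suffice 0 (colors 0 L) L ≤-refl))
   in least (colors 0 L) c′ pc′)
  (colors-least 0 χ L z≤n (subst (1 ≤_) (P-elim e χ) (P-positive⁺ G c pc)))

-- Sequences of coefficients and the comparison of averages

shift : (ℕ → ℕ) → ℕ → ℕ
shift f zero    = 0
shift f (suc k) = f k

-- Multiplication by x − d, on coefficients in the falling factorial basis;
-- correct only if f vanishes below d, where k ∸ d is truncated.
times : ℕ → (ℕ → ℕ) → ℕ → ℕ
times d f k = shift f k + (k ∸ d) * f k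

expand : (ℕ → ℕ) → List ℕ → ℕ → ℕ
expand f []      = f
expand f (d ∷ L) = expand (times d f) L

-- For a chromatic polynomial m is the chromatic number and N the order. The lower bound keeps
-- `times` faithful, the upper one lets sums stop at N, and `nonzero` makes `𝐁` positive.
record Supported (m N : ℕ) (f : ℕ → ℕ) : Set where
  field
    below   : ∀ {k} → k < m → f k ≡ 0
    above   : ∀ {k} → N < k → f k ≡ 0
    nonzero : ∃ λ k → 1 ≤ f k
open Supported

-- The constant polynomial 1, which is the chromatic polynomial of the graph without vertices.
δ₀ : ℕ → ℕ
δ₀ zero    = 1
δ₀ (suc _) = 0

δ₀-supported : Supported 0 0 δ₀
δ₀-supported = record
  { below = λ () ; above = λ { {suc k} _ → refl } ; nonzero = 0 , ≤-refl }

times-supported : ∀ {m N f d} → Supported m N f → d ≤ m → Supported (m ⊔ suc d) (suc N) (times d f)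
times-supported {m} {N} {f} {d} s d≤m = record
  { below = λ {k} → low k ; above = λ {k} → high k ; nonzero = let k , l = nonzero s in suc k , ≤-trans l (m≤m+n (f k) _) }
  where
  low : ∀ k → k < m ⊔ suc d → times d f k ≡ 0
  low zero    l = cong (_* f 0) (0∸n≡0 d)
  low (suc k) l with suc k <? m
  ... | yes sk<m = cong₂ _+_ (below s (<⇒≤ sk<m)) (trans (cong ((suc k ∸ d) *_) (below s sk<m)) (*-zeroʳ (suc k ∸ d)))
  -- Here k + 1 ≤ d: the factor `suc k ∸ d` is zero, and the shifted term vanishes because k < d ≤
  -- m. For d = m this raises the lower bound to m + 1.
  ... | no  sk≮m = cong₂ _+_ (below s (≤-trans sk≤d d≤m)) (cong (_* f (suc k)) (m≤n⇒m∸n≡0 sk≤d))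
    where
    sk≤d : suc k ≤ d
    sk≤d = case m≤n⊔o⇒ l of λ { (inj₁ p) → contradiction p sk≮m ; (inj₂ p) → s≤s⁻¹ p }
      where
      m≤n⊔o⇒ : suc (suc k) ≤ m ⊔ suc d → (suc (suc k) ≤ m) ⊎ (suc (suc k) ≤ suc d)
      m≤n⊔o⇒ p with ⊔-sel m (suc d)
      ... | inj₁ e = inj₁ (subst (suc (suc k) ≤_) e p)
      ... | inj₂ e = inj₂ (subst (suc (suc k) ≤_) e p)
  high : ∀ k → suc N < k → times d f k ≡ 0
  high (suc k) (s≤s l) = cong₂ _+_ (above s l) (trans (cong ((suc k ∸ d) *_) (above s (m<n⇒m<1+n l))) (*-zeroʳ (suc k ∸ d)))

expand-supported : ∀ {m N f L} → Supported m N f → Valid m L →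
  Supported (colors m L) (N + length L) (expand f L)
expand-supported {m} {N} {f} s [] = subst (λ M → Supported m M f) (sym (+-identityʳ N)) s
expand-supported {m} {N} {f} {d ∷ L} s (d≤m ∷ va) =
  subst (λ M → Supported (colors m (d ∷ L)) M (expand f (d ∷ L))) (sym (+-suc N (length L))) (expand-supported (times-supported s d≤m) va)

times-cong : ∀ d {f g} → f ≗ g → times d f ≗ times d g
times-cong d h zero    = cong ((0 ∸ d) *_) (h 0)
times-cong d h (suc k) = cong₂ (λ x y → x + (suc k ∸ d) * y) (h k) (h (suc k))

expand-cong : ∀ L {f g} → f ≗ g → expand f L ≗ expand g L
expand-cong []      h = h
expand-cong (d ∷ L) h = expand-cong L (times-cong d h)

-- The factors x - d and x - e commute. With truncation this uses (k + 1) ∸ d = 1 + (k ∸ d), which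
-- holds for k ≥ m; for k < m the terms that would need it contain `f k`, which is 0.
times-comm : ∀ {m N f d e} → Supported m N f → d ≤ m → e ≤ m → times d (times e f) ≗ times e (times d f)
times-comm {f = f} {d} {e} s d≤m e≤m zero =
  trans (cong (_* times e f 0) (0∸n≡0 d)) (sym (cong (_* times d f 0) (0∸n≡0 e)))
times-comm {m} {f = f} {d} {e} s d≤m e≤m (suc k) with k <? m
... | yes k<m rewrite below s k<m = swap (shift f k) (k ∸ e) (k ∸ d) (suc k ∸ d) (suc k ∸ e) (f (suc k))
  where
  swap : ∀ h a b c d x → h + a * 0 + c * (0 + d * x) ≡ h + b * 0 + d * (0 + c * x)
  swap = solve-∀
... | no k≮m rewrite +-∸-assoc 1 (≤-trans d≤m (≮⇒≥ k≮m)) | +-∸-assoc 1 (≤-trans e≤m (≮⇒≥ k≮m)) =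
  swap (shift f k) (k ∸ e) (k ∸ d) (f k) (f (suc k))
  where
  swap : ∀ h a b x y → h + a * x + (1 + b) * (x + (1 + a) * y) ≡ h + b * x + (1 + a) * (x + (1 + b) * y)
  swap = solve-∀

-- Iterated `times-comm`: a changed factor moves behind the tail that two lists share, where
-- `times-monotone` can compare it.
expand-times : ∀ {m N f d L} → Supported m N f → d ≤ m → Valid m L →
  expand (times d f) L ≗ times d (expand f L)
expand-times s d≤m [] k = refl
expand-times {m} {L = x ∷ L} s d≤m (x≤m ∷ va) k = trans
  (expand-cong L (times-comm s x≤m d≤m) k)
  (expand-times (times-supported s x≤m) (≤-trans d≤m (m≤m⊔n m (suc x))) va k)

-- Summation by parts: the factor x - d moves from the coefficients to the test function g. Taking
-- `fall k`, 1 or the identity for g gives evaluation at k and the moments `𝐁` and `𝐓`.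
∑≤-times : ∀ {m N f} d → Supported m N f → ∀ (g : ℕ → ℕ) →
  ∑≤ (suc N) (λ k → g k * times d f k) ≡ ∑≤ N (λ k → (g (suc k) + (k ∸ d) * g k) * f k)
∑≤-times {m} {N} {f} d s g = begin
  ∑≤ (suc N) (λ k → g k * times d f k)
    ≡⟨ ∑≤-cong (suc N) (λ k → expand-product (g k) (shift f k) (k ∸ d) (f k)) ⟩
  ∑≤ (suc N) (λ k → g k * shift f k + h k)
    ≡⟨ ∑≤-+ (suc N) (λ k → g k * shift f k) h ⟩
  ∑≤ (suc N) (λ k → g k * shift f k) + ∑≤ (suc N) h
    ≡⟨ cong₂ _+_ (trans (∑≤-suc N (λ k → g k * shift f k)) (cong (_+ ∑≤ N (λ k → g (suc k) * f k)) (*-zeroʳ (g 0))))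
                 (trans (∑≤-last N h) (trans (cong (∑≤ N h +_) last) (+-identityʳ _))) ⟩
  ∑≤ N (λ k → g (suc k) * f k) + ∑≤ N h
    ≡⟨ ∑≤-+ N (λ k → g (suc k) * f k) h ⟨
  ∑≤ N (λ k → g (suc k) * f k + h k)
    ≡⟨ ∑≤-cong N (λ k → sym (*-distribʳ-+ (f k) (g (suc k)) ((k ∸ d) * g k))) ⟩
  ∑≤ N (λ k → (g (suc k) + (k ∸ d) * g k) * f k) ∎
  where
  h : ℕ → ℕ
  h k = (k ∸ d) * g k * f k
  last : h (suc N) ≡ 0
  last = trans (cong ((suc N ∸ d) * g (suc N) *_) (above s ≤-refl)) (*-zeroʳ ((suc N ∸ d) * g (suc N)))
  expand-product : ∀ a b c x → a * (b + c * x) ≡ a * b + c * a * x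
  expand-product = solve-∀

fall-suc : ∀ k t → fall k (suc t) ≡ (k ∸ t) * fall k t
fall-suc k       zero    = trans (last k) (sym (*-identityʳ k))
  where
  last : ∀ k → fall k 1 ≡ k
  last zero    = refl
  last (suc k) = *-identityʳ (suc k)
fall-suc zero    (suc t) = refl
fall-suc (suc k) (suc t) = begin
  suc k * fall k (suc t)            ≡⟨ cong (suc k *_) (fall-suc k t) ⟩
  suc k * ((k ∸ t) * fall k t)      ≡⟨ swap (suc k) (k ∸ t) (fall k t) ⟩
  (k ∸ t) * (suc k * fall k t)      ∎
  where
  swap : ∀ a b c → a * (b * c) ≡ b * (a * c)
  swap = solve-∀

fall-zero : ∀ {k t} → k < t → fall k t ≡ 0
fall-zero {zero}  {suc t} l       = refl
fall-zero {suc k} {suc t} (s≤s l) = trans (cong (suc k *_) (fall-zero l)) (*-zeroʳ (suc k))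

-- Write k - d as (k - t) + (t - d); the first part extends the falling factorial by a factor. This
-- is the origin of the weights in `times`. For t > k, where `k ∸ t` is truncated, the falling
-- factorial vanishes.
fall-times : ∀ k t d → d ≤ t → fall k (suc t) + (t ∸ d) * fall k t ≡ (k ∸ d) * fall k t
fall-times k t d d≤t rewrite fall-suc k t with t ≤? k
... | yes t≤k = trans (sym (*-distribʳ-+ (fall k t) (k ∸ t) (t ∸ d))) (cong (_* fall k t) (begin
  (k ∸ t) + (t ∸ d) ≡⟨ +-∸-assoc (k ∸ t) d≤t ⟨
  (k ∸ t + t) ∸ d   ≡⟨ cong (_∸ d) (m∸n+n≡m t≤k) ⟩
  k ∸ d             ∎))
... | no  t≰k rewrite fall-zero (≰⇒> t≰k) =
  trans (cong₂ _+_ (*-zeroʳ (k ∸ t)) (*-zeroʳ (t ∸ d))) (sym (*-zeroʳ (k ∸ d)))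

expand-evaluates : ∀ {m N f L} k → Supported m N f → Valid m L →
  ∑≤ (N + length L) (λ t → fall k t * expand f L t) ≡ ∑≤ N (λ t → fall k t * f t) * fallingProduct k L
expand-evaluates {N = N} {f} k s [] rewrite +-identityʳ N = sym (*-identityʳ _)
expand-evaluates {m} {N} {f} {d ∷ L} k s (d≤m ∷ va) rewrite +-suc N (length L) = begin
  ∑≤ (suc N + length L) (λ t → fall k t * expand (times d f) L t)
    ≡⟨ expand-evaluates k (times-supported s d≤m) va ⟩
  ∑≤ (suc N) (λ t → fall k t * times d f t) * fallingProduct k L
    ≡⟨ cong (_* fallingProduct k L) (∑≤-times d s (fall k)) ⟩
  ∑≤ N (λ t → (fall k (suc t) + (t ∸ d) * fall k t) * f t) * fallingProduct k L
    ≡⟨ cong (_* fallingProduct k L) (∑≤-cong N pointwise) ⟩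
  ∑≤ N (λ t → (k ∸ d) * (fall k t * f t)) * fallingProduct k L
    ≡⟨ cong (_* fallingProduct k L) (∑≤-* N (k ∸ d) (λ t → fall k t * f t)) ⟩
  (k ∸ d) * ∑≤ N (λ t → fall k t * f t) * fallingProduct k L
    ≡⟨ assoc-swap (k ∸ d) (∑≤ N (λ t → fall k t * f t)) (fallingProduct k L) ⟩
  ∑≤ N (λ t → fall k t * f t) * fallingProduct k (d ∷ L) ∎
  where
  assoc-swap : ∀ a b c → a * b * c ≡ b * (a * c)
  assoc-swap = solve-∀
  pointwise : ∀ t → (fall k (suc t) + (t ∸ d) * fall k t) * f t ≡ (k ∸ d) * (fall k t * f t)
  pointwise t with t <? m
  ... | yes t<m rewrite below s t<m =
    trans (*-zeroʳ (fall k (suc t) + (t ∸ d) * fall k t)) (sym (trans (cong ((k ∸ d) *_) (*-zeroʳ (fall k t))) (*-zeroʳ (k ∸ d))))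
  ... | no  t≮m = trans (cong (_* f t) (fall-times k t d (≤-trans d≤m (≮⇒≥ t≮m)))) (*-assoc (k ∸ d) (fall k t) (f t))

𝐁 𝐓 : ℕ → (ℕ → ℕ) → ℕ
𝐁 N f = ∑≤ N f
𝐓 N f = ∑≤ N (λ k → k * f k)

𝐁-positive : ∀ {m N f} → Supported m N f → 1 ≤ 𝐁 N f
𝐁-positive {N = N} {f} s with nonzero s
... | k , l with k ≤? N
...   | yes k≤N = ∑≤-positive N f k≤N l
...   | no  k≰N = contradiction (subst (1 ≤_) (above s (≰⇒> k≰N)) l) λ ()

module _ {m N f} (s : Supported m N f) where

  private
    a = ∑≤ N f
    b = ∑≤ N (λ k → k * f k)
    c = ∑≤ N (λ k → k * (k * f k))

    ∑≤-pointwise : ∀ {d} {g h : ℕ → ℕ} → d ≤ m → (∀ k → d ≤ k → g k ≡ h k) →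
      (∀ k → f k ≡ 0 → g k ≡ h k) → ∑≤ N g ≡ ∑≤ N h
    ∑≤-pointwise {d} d≤m p q = ∑≤-cong N λ k → case k <? m of λ
      { (yes k<m) → q k (below s k<m) ; (no k≮m) → p k (≤-trans d≤m (≮⇒≥ k≮m)) }

  -- The test function 1 in `∑≤-times` gives the weight 1 + k - d, hence a + b - d a, with the
  -- subtracted term kept on the left. For `𝐓` the identity gives a + b + c - d b.
  𝐁-times : ∀ {d} → d ≤ m → 𝐁 (suc N) (times d f) + d * a ≡ a + b
  𝐁-times {d} d≤m = begin
    𝐁 (suc N) (times d f) + d * a
      ≡⟨ cong₂ _+_ (trans (∑≤-cong (suc N) (λ k → sym (*-identityˡ (times d f k)))) (∑≤-times d s (λ _ → 1))) (sym (∑≤-* N d f)) ⟩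
    ∑≤ N (λ k → (1 + (k ∸ d) * 1) * f k) + ∑≤ N (λ k → d * f k)
      ≡⟨ ∑≤-+ N (λ k → (1 + (k ∸ d) * 1) * f k) (λ k → d * f k) ⟨
    ∑≤ N (λ k → (1 + (k ∸ d) * 1) * f k + d * f k)
      ≡⟨ ∑≤-pointwise d≤m
           (λ k d≤k → trans (eq (k ∸ d) d (f k)) (cong (λ x → f k + x * f k) (m∸n+n≡m d≤k)))
           (λ k e → trans (cong (λ x → (1 + (k ∸ d) * 1) * x + d * x) e) (trans (eq₀ (k ∸ d) d k) (cong (λ x → x + k * x) (sym e)))) ⟩
    ∑≤ N (λ k → f k + k * f k)
      ≡⟨ ∑≤-+ N f (λ k → k * f k) ⟩
    a + b ∎
    where
    eq : ∀ e d x → (1 + e * 1) * x + d * x ≡ x + (e + d) * x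
    eq = solve-∀
    eq₀ : ∀ e d k → (1 + e * 1) * 0 + d * 0 ≡ 0 + k * 0
    eq₀ = solve-∀

  𝐓-times : ∀ {d} → d ≤ m → 𝐓 (suc N) (times d f) + d * b ≡ a + b + c
  𝐓-times {d} d≤m = begin
    𝐓 (suc N) (times d f) + d * b
      ≡⟨ cong₂ _+_ (∑≤-times d s (λ k → k)) (sym (∑≤-* N d (λ k → k * f k))) ⟩
    ∑≤ N (λ k → (suc k + (k ∸ d) * k) * f k) + ∑≤ N (λ k → d * (k * f k))
      ≡⟨ ∑≤-+ N (λ k → (suc k + (k ∸ d) * k) * f k) (λ k → d * (k * f k)) ⟨
    ∑≤ N (λ k → (suc k + (k ∸ d) * k) * f k + d * (k * f k))
      ≡⟨ ∑≤-pointwise d≤m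
           (λ k d≤k → trans (eq (k ∸ d) d k (f k)) (cong (λ x → f k + k * f k + x * (k * f k)) (m∸n+n≡m d≤k)))
           (λ k e → trans (cong (λ x → (suc k + (k ∸ d) * k) * x + d * (k * x)) e) (trans (eq₀ (k ∸ d) d k) (cong (λ x → x + k * x + k * (k * x)) (sym e)))) ⟩
    ∑≤ N (λ k → f k + k * f k + k * (k * f k))
      ≡⟨ trans (∑≤-+ N (λ k → f k + k * f k) (λ k → k * (k * f k))) (cong (_+ c) (∑≤-+ N f (λ k → k * f k))) ⟩
    a + b + c ∎
    where
    eq : ∀ e d k x → (1 + k + e * k) * x + d * (k * x) ≡ x + k * x + (e + d) * (k * x)
    eq = solve-∀
    eq₀ : ∀ e d k → (1 + k + e * k) * 0 + d * (k * 0) ≡ 0 + k * 0 + k * (k * 0)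
    eq₀ = solve-∀

  times-monotone : ∀ {d e} → e < d → d ≤ m →
    𝐓 (suc N) (times e f) * 𝐁 (suc N) (times d f) < 𝐓 (suc N) (times d f) * 𝐁 (suc N) (times e f)
  times-monotone {d} {e} e<d d≤m =
    subst₂ (λ T B → T * Bd < Td * B)
      (sym (shrink e≤m Td (𝐓-times d≤m) (𝐓-times e≤m)))
      (sym (shrink e≤m Bd (𝐁-times d≤m) (𝐁-times e≤m)))
      -- `suc δ` has to be d - e, hence δ = `d ∸ suc e`; `shrink` expresses the moments for e
      -- through those for d.
      (ratio-increases {a} {b} {c} {Bd} {Td} d (d ∸ suc e) (𝐁-positive s)
        (∑≤-cauchy-schwarz N f) (𝐁-times d≤m) (𝐓-times d≤m))
    where
    e≤m = ≤-trans (<⇒≤ e<d) d≤m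
    Bd = 𝐁 (suc N) (times d f)
    Td = 𝐓 (suc N) (times d f)
    shrink : ∀ {x y z} → e ≤ m → ∀ w → w + d * x ≡ z → y + e * x ≡ z → y ≡ w + suc (d ∸ suc e) * x
    shrink {x} {y} {z} _ w p q = +-cancelʳ-≡ (e * x) y _ (begin
      y + e * x                                  ≡⟨ trans q (sym p) ⟩
      w + d * x                                  ≡⟨ cong (λ t → w + t * x) (sym (m+[n∸m]≡n e<d)) ⟩
      w + (suc e + (d ∸ suc e)) * x              ≡⟨ eq w e (d ∸ suc e) x ⟩
      w + suc (d ∸ suc e) * x + e * x            ∎)
      where
      eq : ∀ w e r x → w + (1 + e + r) * x ≡ w + (1 + r) * x + e * x
      eq = solve-∀

-- Domination of degree lists

infix 4 _⊢_≽_

-- Entries are lowered in place, and m counts the colors forced by the larger list. `drop` asks the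
-- lowered tail to be valid from m already, without the help of d or e, so that it can be expanded
-- first and the changed factor multiplied last.
data _⊢_≽_ : ℕ → List ℕ → List ℕ → Set where
  []   : ∀ {m} → m ⊢ [] ≽ []
  keep : ∀ {m d L L′} → d ≤ m → (m ⊔ suc d) ⊢ L ≽ L′ → m ⊢ d ∷ L ≽ d ∷ L′
  drop : ∀ {m d e L L′} → e < d → d ≤ m → Valid m L′ → (m ⊔ suc d) ⊢ L ≽ L′ → m ⊢ d ∷ L ≽ e ∷ L′

≽-length : ∀ {m L L′} → m ⊢ L ≽ L′ → length L ≡ length L′
≽-length []           = refl
≽-length (keep _ r)   = cong suc (≽-length r)
≽-length (drop _ _ _ r) = cong suc (≽-length r)

≽-validˡ : ∀ {m L L′} → m ⊢ L ≽ L′ → Valid m L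
≽-validˡ []             = []
≽-validˡ (keep l r)     = l ∷ ≽-validˡ r
≽-validˡ (drop _ l _ r) = l ∷ ≽-validˡ r

valid-mono : ∀ {m m′ L} → m ≤ m′ → Valid m L → Valid m′ L
valid-mono l []                = []
valid-mono l (_∷_ {d = d} h v) = ≤-trans h l ∷ valid-mono (⊔-monoˡ-≤ (suc d) l) v

Larger : ℕ → (ℕ → ℕ) → (ℕ → ℕ) → Set
Larger M f g = 𝐓 M g * 𝐁 M f < 𝐓 M f * 𝐁 M g

Larger-resp : ∀ {M f f′ g g′} → f ≗ f′ → g ≗ g′ → Larger M f g → Larger M f′ g′
Larger-resp {M} p q = subst₂ _<_
  (cong₂ _*_ (∑≤-cong M (λ k → cong (k *_) (q k))) (∑≤-cong M p))
  (cong₂ _*_ (∑≤-cong M (λ k → cong (k *_) (p k))) (∑≤-cong M q))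

-- Lower the tail behind d by induction, then lower d to e in front of the new tail. The
-- intermediate list is `d ∷ L′`, and the two comparisons combine by `cross-trans`.
≽-compare : ∀ {m N f L L′} → Supported m N f → m ⊢ L ≽ L′ →
  L ≡ L′ ⊎ Larger (N + length L) (expand f L) (expand f L′)
≽-compare s [] = inj₁ refl
≽-compare {N = N} {f} {d ∷ L} {_ ∷ L′} s (keep d≤m r) with ≽-compare (times-supported s d≤m) r
... | inj₁ refl = inj₁ refl
... | inj₂ l    = inj₂ (subst (λ M → Larger M (expand f (d ∷ L)) (expand f (d ∷ L′))) (sym (+-suc N (length L))) l)
≽-compare {m} {N} {f} {d ∷ L} {e ∷ L′} s (drop e<d d≤m va r) =
  inj₂ (subst (λ M → Larger M (expand f (d ∷ L)) (expand f (e ∷ L′))) (sym (+-suc N (length L))) total)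
  where
  last-step : Larger (suc (N + length L)) (expand f (d ∷ L′)) (expand f (e ∷ L′))
  last-step = subst (λ x → Larger (suc (N + x)) (expand f (d ∷ L′)) (expand f (e ∷ L′))) (sym (≽-length r))
    (Larger-resp {suc (N + length L′)}
      (sym ∘ expand-times s d≤m va) (sym ∘ expand-times s (≤-trans (<⇒≤ e<d) d≤m) va)
      (times-monotone (expand-supported s va) e<d (≤-trans d≤m (colors-≥ m L′))))
  total : Larger (suc (N + length L)) (expand f (d ∷ L)) (expand f (e ∷ L′))
  total with ≽-compare (times-supported s d≤m) r
  ... | inj₁ refl = last-step
  ... | inj₂ l    = cross-trans {𝐓 M (expand f (d ∷ L))} {𝐁 M (expand f (d ∷ L))} {𝐓 M (expand f (d ∷ L′))} {𝐁 M (expand f (d ∷ L′))} {𝐓 M (expand f (e ∷ L′))} {𝐁 M (expand f (e ∷ L′))}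
    (𝐁-positive (expand-supported (times-supported s d≤m) (≽-validˡ r))) last-step (<⇒≤ l)
    where M = suc (N + length L)

-- Averages depend only on the chromatic polynomial. The lists of the extremal graphs follow the
-- order of L and are tied to those graphs through the product formula alone.
record Realizes {n} (G : Graph n) (L : List ℕ) : Set where
  constructor realizes
  field
    valid      : Valid 0 L
    has-length : length L ≡ n
    chromatic  : ∀ k → P G k ≡ fallingProduct k L

elim-realizes : ∀ {n} {G : Graph n} {L} → Elim G L → Realizes G L
elim-realizes e = realizes (elim-valid e) (elim-length e) (P-elim e)

realizes-S : ∀ {n} {G : Graph n} {L} → Realizes G L → ∀ t → t ≤ n → S G t ≡ expand δ₀ L t
realizes-S {G = G} {L} (realizes va refl h) = S-determined G (expand δ₀ L) λ k →
  trans (h k) (sym (trans (expand-evaluates k δ₀-supported va) (trans (cong (_* fallingProduct k L) (trans (∑≤-sumFrom1 0 _) (+-identityʳ _))) (*-identityˡ _))))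

sumFrom1-cong : ∀ n {f g : ℕ → ℕ} → (∀ t → t ≤ n → f t ≡ g t) → sumFrom1 n f ≡ sumFrom1 n g
sumFrom1-cong zero    h = refl
sumFrom1-cong (suc n) h = cong₂ _+_ (sumFrom1-cong n (λ t l → h t (m≤n⇒m≤1+n l))) (h (suc n) ≤-refl)

realizes-𝓣 : ∀ {n} {G : Graph n} {L} → Realizes G L → 𝓣 G ≡ 𝐓 n (expand δ₀ L)
realizes-𝓣 {n} {G} {L} r = trans (sumFrom1-cong n (λ t l → cong (t *_) (realizes-S r t l)))
  (sym (∑≤-sumFrom1 n (λ k → k * expand δ₀ L k)))

-- `𝓑` starts at k = 1 and `𝐁` at k = 0. The extra coefficient vanishes since there is a vertex: the
-- first entry is 0, and after it the support starts at 1.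
realizes-𝓑 : ∀ {n} {G : Graph (suc n)} {L} → Realizes G L → 𝓑 G ≡ 𝐁 (suc n) (expand δ₀ L)
realizes-𝓑 {n} {G} {L} r@(realizes va len _) = trans (sumFrom1-cong (suc n) (realizes-S r))
  (sym (trans (∑≤-sumFrom1 (suc n) (expand δ₀ L)) (cong (_+ sumFrom1 (suc n) (expand δ₀ L)) (no-color L va len))))
  where
  no-color : ∀ L → Valid 0 L → length L ≡ suc n → expand δ₀ L 0 ≡ 0
  no-color (d ∷ L) (d≤0 ∷ va) _ = below (expand-supported (times-supported δ₀-supported d≤0) va) (≤-trans (s≤s z≤n) (colors-≥ (suc d) L))

average-compare : ∀ {n} {G H : Graph (suc n)} {L L′} → Realizes G L → Realizes H L′ → 0 ⊢ L ≽ L′ →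
  (L ≡ L′ × G A≡ H) ⊎ (𝓣 H * 𝓑 G < 𝓣 G * 𝓑 H)
average-compare {G = G} {H} {L} {L′} r@(realizes _ len _) r′ c with ≽-compare δ₀-supported c
... | inj₁ refl = inj₁ (refl , cong₂ _*_ (trans (realizes-𝓣 r) (sym (realizes-𝓣 r′))) (trans (realizes-𝓑 r′) (sym (realizes-𝓑 r))))
... | inj₂ l    = inj₂ (subst₂ _<_
  (sym (cong₂ _*_ (realizes-𝓣 r′) (realizes-𝓑 r))) (sym (cong₂ _*_ (realizes-𝓣 r) (realizes-𝓑 r′)))
  (subst (λ M → Larger M (expand δ₀ L) (expand δ₀ L′)) len l))

module _ {n} {G H : Graph n} (i : G ≅ H) where

  iso-S : ∀ t → t ≤ n → S G t ≡ S H t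
  iso-S = S-determined G (S H) λ k → trans (P-iso {G = G} {H} i k) (P-expansion H k)

  iso-𝓣 : 𝓣 G ≡ 𝓣 H
  iso-𝓣 = sumFrom1-cong n (λ t l → cong (t *_) (iso-S t l))

  iso-𝓑 : 𝓑 G ≡ 𝓑 H
  iso-𝓑 = sumFrom1-cong n iso-S

  iso-A≡ : G A≡ H
  iso-A≡ = cong₂ _*_ iso-𝓣 (sym iso-𝓑)

-- Extremal lists and graphs

clip : ℕ → ℕ → ℕ
clip m d = if d <ᵇ m then 0 else d

clip-small : ∀ {m d} → d < m → clip m d ≡ 0
clip-small {m} {d} d<m = cong (λ b → if b then 0 else d) (<ᵇ-complete d<m)

-- The degrees of a complete graph with isolated vertices, placed so that they
-- are dominated by L: only the entries that open a new color survive.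
cliqueList : ℕ → List ℕ → List ℕ
cliqueList m []      = []
cliqueList m (d ∷ L) = clip m d ∷ cliqueList (m ⊔ suc d) L

cliqueList-∷ʳ : ∀ m L d → cliqueList m (L ∷ʳ d) ≡ cliqueList m L ∷ʳ clip (colors m L) d
cliqueList-∷ʳ m []      d = refl
cliqueList-∷ʳ m (x ∷ L) d = cong (clip m x ∷_) (cliqueList-∷ʳ (m ⊔ suc x) L d)

cliqueList-valid : ∀ {m L} → Valid m L → Valid m (cliqueList m L)
cliqueList-valid [] = []
cliqueList-valid {m} {d ∷ L} (d≤m ∷ va) with d <? m
... | yes d<m rewrite <ᵇ-complete d<m = z≤n ∷ valid-mono (≤-trans (≤-reflexive (m≥n⇒m⊔n≡m d<m)) (m≤m⊔n m 1)) (cliqueList-valid va)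
... | no  d≮m rewrite <ᵇ-false (≮⇒≥ d≮m) = d≤m ∷ cliqueList-valid va

≽-cliqueList : ∀ {m L} → Valid m L → m ⊢ L ≽ cliqueList m L
≽-cliqueList [] = []
≽-cliqueList {m} {d ∷ L} (d≤m ∷ va) with d <? m
≽-cliqueList {m} {zero ∷ L}  (d≤m ∷ va) | yes d<m rewrite <ᵇ-complete d<m = keep d≤m (≽-cliqueList va)
≽-cliqueList {m} {suc d ∷ L} (d≤m ∷ va) | yes d<m rewrite <ᵇ-complete d<m =
  drop z<s d≤m (valid-mono (≤-reflexive (m≥n⇒m⊔n≡m d<m)) (cliqueList-valid va)) (≽-cliqueList va)
≽-cliqueList {m} {d ∷ L}     (d≤m ∷ va) | no  d≮m rewrite <ᵇ-false (≮⇒≥ d≮m) = keep d≤m (≽-cliqueList va)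

repeats : ℕ → List ℕ → ℕ
repeats m []      = 0
repeats m (d ∷ L) = ⟦ d <ᵇ m ⟧ + repeats (m ⊔ suc d) L

repeats+colors : ∀ {m L} → Valid m L → repeats m L + colors m L ≡ m + length L
repeats+colors {m} [] = sym (+-identityʳ m)
repeats+colors {m} {d ∷ L} (d≤m ∷ va) with d <? m
... | yes d<m rewrite <ᵇ-complete d<m = trans (cong suc (trans (repeats+colors va) (cong (_+ length L) (m≥n⇒m⊔n≡m d<m)))) (sym (+-suc m (length L)))
... | no  d≮m rewrite <ᵇ-false (≮⇒≥ d≮m) = trans (repeats+colors va) (trans (cong (_+ length L) m⊔) (sym (+-suc m (length L))))
  where
  m⊔ : m ⊔ suc d ≡ suc m
  m⊔ = trans (m≤n⇒m⊔n≡n (m≤n⇒m≤1+n (≮⇒≥ d≮m))) (cong suc (≤-antisym d≤m (≮⇒≥ d≮m)))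

-- The surviving entries are m, m + 1, ... in order, each adding the next factor to the falling
-- factorial; each clipped entry contributes a factor k.
cliqueList-product : ∀ {m L} k → Valid m L →
  fall k m * fallingProduct k (cliqueList m L) ≡ fall k (colors m L) * k ^ repeats m L
cliqueList-product k [] = refl
cliqueList-product {m} {d ∷ L} k (d≤m ∷ va) with d <? m | cliqueList-product k va
... | yes d<m | ih rewrite <ᵇ-complete d<m | m≥n⇒m⊔n≡m d<m =
  trans (swap (fall k m) k _) (trans (cong (k *_) ih) (swap k (fall k (colors m L)) _))
  where
  swap : ∀ a b c → a * (b * c) ≡ b * (a * c)
  swap = solve-∀
... | no d≮m | ih rewrite <ᵇ-false (≮⇒≥ d≮m) = trans (sym (*-assoc (fall k m) (k ∸ d) _)) (trans (cong (_* fallingProduct k (cliqueList (m ⊔ suc d) L)) fall-m) ih)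
  where
  m≡d : m ≡ d
  m≡d = ≤-antisym (≮⇒≥ d≮m) d≤m
  fall-m : fall k m * (k ∸ d) ≡ fall k (m ⊔ suc d)
  fall-m = begin
    fall k m * (k ∸ d)  ≡⟨ cong (λ x → fall k x * (k ∸ d)) m≡d ⟩
    fall k d * (k ∸ d)  ≡⟨ *-comm (fall k d) (k ∸ d) ⟩
    (k ∸ d) * fall k d  ≡⟨ fall-suc k d ⟨
    fall k (suc d)      ≡⟨ cong (fall k) (sym (m≤n⇒m⊔n≡n (m≤n⇒m≤1+n (≮⇒≥ d≮m)))) ⟩
    fall k (m ⊔ suc d)  ∎

sign : ℕ → ℕ
sign zero    = 0
sign (suc _) = 1

nonzeros : List ℕ → ℕ
nonzeros []      = 0
nonzeros (d ∷ L) = sign d + nonzeros L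

nonzeros-∷ʳ : ∀ L d → nonzeros (L ∷ʳ d) ≡ nonzeros L + sign d
nonzeros-∷ʳ []      d = +-identityʳ (sign d)
nonzeros-∷ʳ (x ∷ L) d = trans (cong (sign x +_) (nonzeros-∷ʳ L d)) (sym (+-assoc (sign x) _ _))

-- The degrees of a star with q leaves and isolated vertices, likewise
-- dominated by L when L has at least q nonzero entries.
starList : ℕ → List ℕ → List ℕ
starList q       []          = []
starList q       (zero ∷ L)  = 0 ∷ starList q L
starList zero    (suc d ∷ L) = 0 ∷ starList zero L
starList (suc q) (suc d ∷ L) = 1 ∷ starList q L

starList-valid : ∀ {m} → 1 ≤ m → ∀ q L → Valid m (starList q L)
starList-valid 1≤m q       []          = []
starList-valid {m} 1≤m q   (zero ∷ L)  = z≤n ∷ starList-valid (≤-trans 1≤m (m≤m⊔n m 1)) q L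
starList-valid {m} 1≤m zero (suc d ∷ L) = z≤n ∷ starList-valid (≤-trans 1≤m (m≤m⊔n m 1)) zero L
starList-valid {m} 1≤m (suc q) (suc d ∷ L) = 1≤m ∷ starList-valid (≤-trans 1≤m (m≤m⊔n m 2)) q L

≽-starList : ∀ {m} → 1 ≤ m → ∀ q {L} → Valid m L → m ⊢ L ≽ starList q L
≽-starList 1≤m q [] = []
≽-starList {m} 1≤m q       {zero ∷ L}          (l ∷ va) = keep l (≽-starList (≤-trans 1≤m (m≤m⊔n m 1)) q va)
≽-starList {m} 1≤m zero    {suc d ∷ L}         (l ∷ va) =
  drop z<s l (starList-valid 1≤m zero L) (≽-starList (≤-trans 1≤m (m≤m⊔n m _)) zero va)
≽-starList {m} 1≤m (suc q) {suc zero ∷ L}      (l ∷ va) = keep l (≽-starList (≤-trans 1≤m (m≤m⊔n m 2)) q va)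
≽-starList {m} 1≤m (suc q) {suc (suc d) ∷ L}   (l ∷ va) =
  drop (s≤s z<s) l (starList-valid 1≤m q L) (≽-starList (≤-trans 1≤m (m≤m⊔n m _)) q va)

starZeros : ℕ → List ℕ → ℕ
starZeros q       []          = 0
starZeros q       (zero ∷ L)  = suc (starZeros q L)
starZeros zero    (suc d ∷ L) = suc (starZeros zero L)
starZeros (suc q) (suc d ∷ L) = starZeros q L

starZeros+q : ∀ q L → q ≤ nonzeros L → starZeros q L + q ≡ length L
starZeros+q zero    []          l       = refl
starZeros+q q       (zero ∷ L)  l       = cong suc (starZeros+q q L l)
starZeros+q zero    (suc d ∷ L) l       = cong suc (starZeros+q zero L z≤n)
starZeros+q (suc q) (suc d ∷ L) (s≤s l) = trans (+-suc (starZeros q L) q) (cong suc (starZeros+q q L l))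

starList-product : ∀ k q L → q ≤ nonzeros L →
  fallingProduct k (starList q L) ≡ k ^ starZeros q L * (k ∸ 1) ^ q
starList-product k zero    []          l       = refl
starList-product k q       (zero ∷ L)  l       = trans (cong (k *_) (starList-product k q L l)) (sym (*-assoc k _ _))
starList-product k zero    (suc d ∷ L) l       = trans (cong (k *_) (starList-product k zero L z≤n)) (sym (*-assoc k _ _))
starList-product k (suc q) (suc d ∷ L) (s≤s l) = trans (cong ((k ∸ 1) *_) (starList-product k q L l)) (swap (k ∸ 1) (k ^ starZeros q L) ((k ∸ 1) ^ q))
  where
  swap : ∀ a b c → a * (b * c) ≡ b * (a * c)
  swap = solve-∀

starList-nonzeros : ∀ q L → q ≤ nonzeros L → nonzeros (starList q L) ≡ q
starList-nonzeros zero    []          l       = refl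
starList-nonzeros q       (zero ∷ L)  l       = starList-nonzeros q L l
starList-nonzeros zero    (suc d ∷ L) l       = starList-nonzeros zero L z≤n
starList-nonzeros (suc q) (suc d ∷ L) (s≤s l) = cong suc (starList-nonzeros q L l)

starList-≤1 : ∀ q L → All (_≤ 1) (starList q L)
starList-≤1 q       []          = []
starList-≤1 q       (zero ∷ L)  = z≤n ∷ starList-≤1 q L
starList-≤1 zero    (suc d ∷ L) = z≤n ∷ starList-≤1 zero L
starList-≤1 (suc q) (suc d ∷ L) = ≤-refl ∷ starList-≤1 q L

≗⇒≅ : ∀ {n} (G H : Graph n) → (∀ i j → adj H i j ≡ adj G i j) → G ≅ H
≗⇒≅ G H h = Perm.id , h

P-KUnionE : ∀ n c z k → z + c ≡ n → P (KUnionE n c) k ≡ fall k c * k ^ z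
P-KUnionE zero    zero    zero    k refl = refl
P-KUnionE (suc n) zero    (suc z) k eq   = begin
  P (KUnionE (suc n) 0) k                          ≡⟨ P-simplicial G zero simp k ⟩
  P (remove G zero) k * (k ∸ degree G zero)
    ≡⟨ cong₂ (λ p d → p * (k ∸ d)) (P-iso {G = remove G zero} {KUnionE n 0} (≗⇒≅ (remove G zero) (KUnionE n 0) λ _ _ → refl) k)
         (trans (degree-nbr G zero) (sum-zero {n} (λ _ → 0) (λ _ → refl))) ⟩
  P (KUnionE n 0) k * k                            ≡⟨ cong (_* k) (P-KUnionE n 0 z k (suc-injective eq)) ⟩
  fall k 0 * k ^ z * k                             ≡⟨ rearr k (k ^ z) ⟩
  fall k 0 * k ^ suc z                             ∎
  where
  G = KUnionE (suc n) 0
  simp : Simplicial G zero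
  simp zero    w () _ _
  simp (suc u) w () _ _
  rearr : ∀ k x → 1 * x * k ≡ 1 * (k * x)
  rearr = solve-∀
P-KUnionE (suc n) (suc c) z k eq = begin
  P G k                                            ≡⟨ P-simplicial G zero simp k ⟩
  P (remove G zero) k * (k ∸ degree G zero)
    ≡⟨ cong₂ (λ p d → p * (k ∸ d)) (P-iso {G = remove G zero} {KUnionE n c} (≗⇒≅ (remove G zero) (KUnionE n c) λ _ _ → refl) k)
         (trans (degree-nbr G zero) (count-below n c (subst (c ≤_) z+c (m≤n+m c z)))) ⟩
  P (KUnionE n c) k * (k ∸ c)                      ≡⟨ cong (_* (k ∸ c)) (P-KUnionE n c z k z+c) ⟩
  fall k c * k ^ z * (k ∸ c)                       ≡⟨ rearr (fall k c) (k ^ z) (k ∸ c) ⟩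
  (k ∸ c) * fall k c * k ^ z                       ≡⟨ cong (_* k ^ z) (fall-suc k c) ⟨
  fall k (suc c) * k ^ z                           ∎
  where
  G = KUnionE (suc n) (suc c)
  z+c : z + c ≡ n
  z+c = suc-injective (trans (sym (+-suc z c)) eq)
  simp : Simplicial G zero
  simp zero    w () _ _
  simp (suc u) zero _ () _
  simp (suc u) (suc w) p q u≢w rewrite ≢⇒==false u≢w = and-true p q
  rearr : ∀ a b c → a * b * c ≡ c * a * b
  rearr = solve-∀
  count-below : ∀ n c → c ≤ n → sum {n} (λ i → ⟦ toℕ i <ᵇ c ⟧) ≡ c
  count-below n       zero    l       = sum-zero {n} _ λ i → cong ⟦_⟧ (<ᵇ-false {toℕ i} z≤n)
  count-below (suc n) (suc c) (s≤s l) = cong suc (count-below n c l)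

-- The induction eliminates vertex 1, since the center 0 is not simplicial once there are two
-- leaves. Vertex 1 is a leaf for positive q and isolated for q = 0, which gives its degree
-- `⟦ 1 ≤ᵇ q ⟧`.
P-StarUnionE : ∀ n z q k → z + q ≡ n → P (StarUnionE (suc n) q) k ≡ k ^ suc z * (k ∸ 1) ^ q
P-StarUnionE zero zero zero k refl = trans (P-simplicial (StarUnionE 1 0) zero (λ { zero _ () }) k) (eq k)
  where
  eq : ∀ k → 1 * k ≡ k * 1 * 1
  eq = solve-∀
P-StarUnionE (suc n) z q k z+q = begin
  P G k                                             ≡⟨ P-simplicial G one simp k ⟩
  P (remove G one) k * (k ∸ degree G one)           ≡⟨ cong (λ d → P (remove G one) k * (k ∸ d)) deg ⟩
  P (remove G one) k * (k ∸ ⟦ 1 ≤ᵇ q ⟧)             ≡⟨ rest z q z+q ⟩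
  k ^ suc z * (k ∸ 1) ^ q                           ∎
  where
  G = StarUnionE (suc (suc n)) q
  one : Fin (suc (suc n))
  one = suc zero
  simp : Simplicial G one
  simp zero    zero    _ _ u≢w = contradiction refl u≢w
  simp zero    (suc w) _ () _
  simp (suc u) w       () _ _
  deg : degree G one ≡ ⟦ 1 ≤ᵇ q ⟧
  deg = trans (degree-nbr G one) (trans (cong (⟦ 1 ≤ᵇ q ⟧ +_) (sum-zero {n} (λ _ → 0) (λ _ → refl))) (+-identityʳ _))
  rest : ∀ z q → z + q ≡ suc n →
    P (remove (StarUnionE (suc (suc n)) q) one) k * (k ∸ ⟦ 1 ≤ᵇ q ⟧) ≡ k ^ suc z * (k ∸ 1) ^ q
  rest (suc z) zero eq = trans
    (cong (_* k) (trans (P-iso {G = remove (StarUnionE (suc (suc n)) 0) one} {StarUnionE (suc n) 0}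
                     (≗⇒≅ (remove (StarUnionE (suc (suc n)) 0) one) (StarUnionE (suc n) 0) λ { zero zero → refl ; zero (suc _) → refl ; (suc _) zero → refl ; (suc _) (suc _) → refl }) k)
                   (P-StarUnionE n z 0 k (suc-injective eq))))
    (rearr k (k ^ z))
    where
    rearr : ∀ k x → k * x * 1 * k ≡ k * (k * x) * 1
    rearr = solve-∀
  rest z (suc q) eq = trans
    (cong (_* (k ∸ 1)) (trans (P-iso {G = remove (StarUnionE (suc (suc n)) (suc q)) one} {StarUnionE (suc n) q}
                     (≗⇒≅ (remove (StarUnionE (suc (suc n)) (suc q)) one) (StarUnionE (suc n) q) λ { zero zero → refl ; zero (suc _) → refl ; (suc _) zero → refl ; (suc _) (suc _) → refl }) k)
                   (P-StarUnionE n z q k (suc-injective (trans (sym (+-suc z q)) eq)))))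
    (rearr (k ^ suc z) ((k ∸ 1) ^ q) (k ∸ 1))
    where
    rearr : ∀ a b c → a * b * c ≡ a * (c * b)
    rearr = solve-∀

-- The graph recovered from its elimination degrees

sum-pick : ∀ {n} (t : Fin n → ℕ) i → ∃ λ (rest : Fin (pred n) → ℕ) →
  sum t ≡ t i + sum rest × (∀ j → i ≢ j → ∃ λ y → rest y ≡ t j)
sum-pick {suc n} t i = removeAt t i , sum-remove {i = i} t ,
  λ j i≢j → Fin.punchOut i≢j , cong t (Finₚ.punchIn-punchOut i≢j)

two-elements : ∀ {n} (b : Fin n → Bool) {i j} → b i ≡ true → b j ≡ true → i ≢ j → 2 ≤ sum (⟦_⟧ ∘ b)
two-elements b {i} {j} bi bj i≢j with sum-pick (⟦_⟧ ∘ b) i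
... | rest , e , f with f j i≢j
... | y , q = subst (2 ≤_) (sym e)
  (+-mono-≤ (⟦⟧-positive⁺ bi) (sum-positive rest y (subst (1 ≤_) (sym q) (⟦⟧-positive⁺ bj))))

another-element : ∀ {n} (b : Fin n → Bool) i → 2 ≤ sum (⟦_⟧ ∘ b) → ∃ λ j → i ≢ j × b j ≡ true
another-element {suc n} b i l with sum-positive⁻ (removeAt (⟦_⟧ ∘ b) i) rest≥1
  where
  ⟦⟧≤1 : ∀ x → ⟦ x ⟧ ≤ 1
  ⟦⟧≤1 true  = ≤-refl
  ⟦⟧≤1 false = z≤n
  rest≥1 : 1 ≤ sum (removeAt (⟦_⟧ ∘ b) i)
  rest≥1 = +-cancelˡ-≤ 1 1 _ (≤-trans (subst (2 ≤_) (sum-remove {i = i} (⟦_⟧ ∘ b)) l) (+-monoˡ-≤ _ (⟦⟧≤1 (b i))))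
... | y , l′ = punchIn i y , punchInᵢ≢i i y ∘ sym , ⟦⟧-positive⁻ l′

⟦⟧-mono : ∀ {x y} → (x ≡ true → y ≡ true) → ⟦ x ⟧ ≤ ⟦ y ⟧
⟦⟧-mono {true}  h = ⟦⟧-positive⁺ (h refl)
⟦⟧-mono {false} h = z≤n

equal-count : ∀ {n} (b b′ : Fin n → Bool) → (∀ i → b i ≡ true → b′ i ≡ true) →
  sum (⟦_⟧ ∘ b) ≡ sum (⟦_⟧ ∘ b′) → ∀ i → b′ i ≡ true → b i ≡ true
equal-count {suc n} b b′ sub eq i b′i = ⟦⟧-positive⁻ (+-cancelʳ-≤ (sum (removeAt (⟦_⟧ ∘ b) i)) 1 ⟦ b i ⟧
  (≤-trans (+-mono-≤ (⟦⟧-positive⁺ b′i) (sum-mono (λ y → ⟦⟧-mono (sub (punchIn i y)))))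
    (≤-reflexive (trans (sym (sum-remove {i = i} (⟦_⟧ ∘ b′))) (trans (sym eq) (sum-remove {i = i} (⟦_⟧ ∘ b)))))))

sum-insertAt : ∀ {n} (b : Fin n → Bool) v x → sum (⟦_⟧ ∘ insertAt b v x) ≡ ⟦ x ⟧ + sum (⟦_⟧ ∘ b)
sum-insertAt b v x = trans (sum-remove {i = v} (⟦_⟧ ∘ insertAt b v x))
  (cong₂ _+_ (cong ⟦_⟧ (insertAt-lookup b v x)) (sum-cong-≗ (λ i → cong ⟦_⟧ (insertAt-punchIn b v x i))))

degree-zero : ∀ {n} (G : Graph n) {u} → degree G u ≡ 0 → ∀ w → adj G u w ≡ false
degree-zero G {u} e w = ≢true⇒false λ a → contradiction
  (subst (1 ≤_) (trans (sym (degree-sum G u)) e) (sum-positive (λ i → ⟦ adj G u i ⟧) w (⟦⟧-positive⁺ a))) λ ()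

sign-≤ : ∀ {d} → d ≤ 1 → d ≡ sign d
sign-≤ {zero}  l = refl
sign-≤ {suc zero} l = refl
sign-≤ {suc (suc d)} (s≤s ())

nbr≤sign : ∀ {n} (G : Graph (suc n)) v w → ⟦ nbr G v w ⟧ ≤ sign (degree G v)
nbr≤sign G v w with nbr G v w in e
... | false = z≤n
... | true with degree G v in q
...   | suc d = ≤-refl
...   | zero  = contradiction (trans (sym e) (degree-zero G q (punchIn v w))) λ ()

-- A surviving vertex loses at most one neighbor with v, and only when the entry of v is nonzero.
-- For v itself, any neighbor w is adjacent to all other neighbors of v, so `degree G v` is at most
-- one more than the degree of w in the rest.
degree≤nonzeros : ∀ {n} {G : Graph n} {L} → Elim G L → ∀ u → degree G u ≤ nonzeros L
degree≤nonzeros {G = G} (peel v {D} s e) u = subst (degree G u ≤_) (sym (nonzeros-∷ʳ D (degree G v))) (go (around v u))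
  where
  go : ∀ {u} → Around v u → degree G u ≤ nonzeros D + sign (degree G v)
  go (there w) = subst (_≤ nonzeros D + sign (degree G v))
    (trans (+-comm (degree (remove G v) w) ⟦ nbr G v w ⟧) (sym (degree-remove G v w)))
    (+-mono-≤ (degree≤nonzeros e w) (nbr≤sign G v w))
  go here with degree G v in q
  ... | zero  = z≤n
  ... | suc d = ≤-trans (subst₂ _≤_ (trans (sym (degree-nbr G v)) q) split clique) (+-monoˡ-≤ 1 (degree≤nonzeros e w))
    where
    found = sum-positive⁻ (⟦_⟧ ∘ nbr G v) (subst (1 ≤_) (trans (sym q) (degree-nbr G v)) (s≤s z≤n))
    w = proj₁ found
    w-nbr : nbr G v w ≡ true
    w-nbr = ⟦⟧-positive⁻ (proj₂ found)
    clique : sum (⟦_⟧ ∘ nbr G v) ≤ sum (λ i → ⟦ adj (remove G v) w i ⟧ + ⟦ w == i ⟧)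
    clique = sum-mono bound
      where
      bound : ∀ i → ⟦ nbr G v i ⟧ ≤ ⟦ adj (remove G v) w i ⟧ + ⟦ w == i ⟧
      bound i with w Finₚ.≟ i
      ... | yes refl = ≤-trans (⟦⟧-mono (λ _ → ==-refl w)) (m≤n+m _ _)
      ... | no  w≢i  = ≤-trans (⟦⟧-mono (λ a → s _ _ w-nbr a (w≢i ∘ Finₚ.punchIn-injective v w i))) (m≤m+n _ _)
    split : sum (λ i → ⟦ adj (remove G v) w i ⟧ + ⟦ w == i ⟧) ≡ degree (remove G v) w + 1
    split = trans (∑-distrib-+ (λ i → ⟦ adj (remove G v) w i ⟧) (λ i → ⟦ w == i ⟧))
      (cong₂ _+_ (sym (degree-sum (remove G v) w)) (sum-== w))

+-tight : ∀ {a b c d} → a ≤ c → b ≤ d → a + b ≡ c + d → a ≡ c × b ≡ d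
+-tight {a} {b} {c} {d} a≤c b≤d e =
  ≤-antisym a≤c (+-cancelʳ-≤ d c a (subst (_≤ a + d) e (+-monoʳ-≤ a b≤d))) ,
  ≤-antisym b≤d (+-cancelˡ-≤ c d b (subst (_≤ c + b) e (+-monoˡ-≤ b a≤c)))

-- Every forest has an elimination list of zeros and ones; equality in `degree≤nonzeros` at u
-- singles out the star. While u survives, the equality persists and a peeled vertex of degree one
-- must hang on u. When u itself is peeled, the remaining entries are all zero and the rest has no
-- edges.
star-shape : ∀ {n} {G : Graph n} {L} → Elim G L → All (_≤ 1) L → ∀ u → degree G u ≡ nonzeros L →
  ∀ i j → adj G i j ≡ true → i ≡ u ⊎ j ≡ u
star-shape {G = G} (peel v {D} s e) small u deg i j = go (around v u) (around v i) (around v j)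
    (trans deg (nonzeros-∷ʳ D (degree G v)))
  where
  small-D = proj₁ (∷ʳ⁻ small)
  d≤1 = proj₂ (∷ʳ⁻ small)
  go : ∀ {u i j} → Around v u → Around v i → Around v j → degree G u ≡ nonzeros D + sign (degree G v) →
    adj G i j ≡ true → i ≡ u ⊎ j ≡ u
  go here here      _         _   a = inj₁ refl
  go here (there x) here      _   a = inj₂ refl
  go here (there x) (there y) deg a = contradiction (trans (sym a) (degree-zero (remove G v) isolated y)) λ ()
    where
    no-nonzeros : nonzeros D ≡ 0
    no-nonzeros = sym (+-cancelʳ-≡ (sign (degree G v)) 0 (nonzeros D) (trans (sym (sign-≤ d≤1)) deg))
    isolated : degree (remove G v) x ≡ 0
    isolated = n≤0⇒n≡0 (subst (degree (remove G v) x ≤_) no-nonzeros (degree≤nonzeros e x))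
  go {u = u} {i} {j} (there w) ri rj deg a = cases ri rj a
    where
    tight : ⟦ nbr G v w ⟧ ≡ sign (degree G v) × degree (remove G v) w ≡ nonzeros D
    tight = +-tight (nbr≤sign G v w) (degree≤nonzeros e w)
      (trans (sym (degree-remove G v w)) (trans deg (+-comm (nonzeros D) (sign (degree G v)))))
    only : ∀ y → nbr G v y ≡ true → y ≡ w
    only y y-nbr with y Finₚ.≟ w
    ... | yes y≡w = y≡w
    ... | no  y≢w = contradiction
      (subst (2 ≤_) (sym (degree-nbr G v)) (two-elements (nbr G v) y-nbr w-nbr y≢w)) (<⇒≱ (s≤s d≤1))
      where
      w-nbr : nbr G v w ≡ true
      w-nbr = ⟦⟧-positive⁻ (subst (1 ≤_) (sym (proj₁ tight))
        (≤-trans (⟦⟧-positive⁺ y-nbr) (nbr≤sign G v y)))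
    cases : ∀ {i j} → Around v i → Around v j → adj G i j ≡ true → i ≡ punchIn v w ⊎ j ≡ punchIn v w
    cases here      here      a = contradiction (trans (sym a) (Graph.irrefl G v)) λ ()
    cases here      (there y) a = inj₂ (cong (punchIn v) (only y a))
    cases (there x) here      a = inj₁ (cong (punchIn v) (only x (trans (Graph.sym G v (punchIn v x)) a)))
    cases (there x) (there y) a = case star-shape e small-D w (proj₂ tight) x y a of λ
      { (inj₁ p) → inj₁ (cong (punchIn v) p) ; (inj₂ p) → inj₂ (cong (punchIn v) p) }

CliqueOn : ∀ {n} → Graph n → (Fin n → Bool) → Set
CliqueOn G K = ∀ i j → adj G i j ≡ not (i == j) ∧ (K i ∧ K j)

not-true⁻ : ∀ {x} → not x ≡ true → x ≡ false
not-true⁻ {false} _ = refl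

cliqueOn⁻ : ∀ {n} {G : Graph n} {K} → CliqueOn G K → ∀ {i j} → adj G i j ≡ true → i ≢ j × K i ≡ true × K j ≡ true
cliqueOn⁻ h {i} {j} a =
  let p , q = ∧-true {not (i == j)} (trans (sym (h i j)) a)
  in (λ { refl → contradiction (trans (sym (not-true⁻ p)) (==-refl i)) λ () }) , ∧-true q

-- The hypothesis makes each peeled vertex either isolated or joined to as many vertices as the rest
-- needs colors. In the second case its neighborhood is a clique as large as K.
clique-shape : ∀ {n} {G : Graph n} {L} → Elim G L → cliqueList 0 L ≡ L →
  ∃ λ K → sum (⟦_⟧ ∘ K) ≡ colors 0 L × CliqueOn G K
clique-shape done _ = (λ ()) , refl , λ ()
clique-shape {suc n} {G} (peel v {D} s e) fixed with ∷ʳ-injective _ _ (trans (sym (cliqueList-∷ʳ 0 D (degree G v))) fixed)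
... | fixed-D , fixed-d with clique-shape e fixed-D
... | K , size , K-clique with degree G v <? colors 0 D
... | yes d<c = insertAt K v false , size′ , λ i j → shape (around v i) (around v j)
  where
  isolated : ∀ w → adj G v w ≡ false
  isolated = degree-zero G (trans (sym fixed-d) (clip-small d<c))
  size′ : sum (⟦_⟧ ∘ insertAt K v false) ≡ colors 0 (D ∷ʳ degree G v)
  size′ = trans (sum-insertAt K v false) (trans size (sym (trans (colors-∷ʳ 0 D (degree G v)) (m≥n⇒m⊔n≡m d<c))))
  shape : ∀ {i j} → Around v i → Around v j → adj G i j ≡ not (i == j) ∧ (insertAt K v false i ∧ insertAt K v false j)
  shape {j = j} here _ rewrite insertAt-lookup K v false = trans (isolated j) (sym (∧-zeroʳ (not (v == j))))
  shape (there x) here rewrite insertAt-lookup K v false | insertAt-punchIn K v false x =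
    trans (trans (Graph.sym G (punchIn v x) v) (isolated (punchIn v x)))
      (sym (trans (cong (not (punchIn v x == v) ∧_) (∧-zeroʳ (K x))) (∧-zeroʳ (not (punchIn v x == v)))))
  shape (there x) (there y) rewrite insertAt-punchIn K v false x | insertAt-punchIn K v false y =
    trans (K-clique x y) (cong (λ b → not b ∧ (K x ∧ K y))
      (≡ᵇ-cong (cong (toℕ ∘ punchIn v) ∘ toℕ-injective) (cong toℕ ∘ Finₚ.punchIn-injective v x y ∘ toℕ-injective)))
-- The new set extends N rather than K: when K has at most one element the rest has no edges, and N
-- may consist of another vertex.
... | no d≮c = insertAt N v true , size′ , λ i j → shape (around v i) (around v j)
  where
  N = nbr G v
  d≡c : degree G v ≡ colors 0 D
  d≡c = ≤-antisym (simplicial-degree≤ G v s (colors 0 D)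
    (subst (1 ≤_) (sym (P-elim e (colors 0 D))) (colors-suffice 0 (colors 0 D) D ≤-refl))) (≮⇒≥ d≮c)
  size′ : sum (⟦_⟧ ∘ insertAt N v true) ≡ colors 0 (D ∷ʳ degree G v)
  size′ = trans (sum-insertAt N v true) (trans (cong suc (sym (degree-nbr G v)))
    (sym (trans (colors-∷ʳ 0 D (degree G v)) (m≤n⇒m⊔n≡n (m≤n⇒m≤1+n (≮⇒≥ d≮c))))))
  N-K : sum (⟦_⟧ ∘ N) ≡ sum (⟦_⟧ ∘ K)
  N-K = trans (sym (degree-nbr G v)) (trans d≡c (sym size))
  N-adj : ∀ {x y} → x ≢ y → N x ≡ true → N y ≡ true → adj (remove G v) x y ≡ true
  N-adj x≢y p q = s _ _ p q (x≢y ∘ Finₚ.punchIn-injective v _ _)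
  -- If K has two elements then so has N, which makes N a clique inside K.
  K⊆N : 2 ≤ sum (⟦_⟧ ∘ K) → ∀ i → K i ≡ true → N i ≡ true
  K⊆N l = equal-count N K
    (λ i Ni → let j , i≢j , Nj = another-element N i (subst (2 ≤_) (sym N-K) l)
              in proj₁ (proj₂ (cliqueOn⁻ {G = remove G v} {K} K-clique (N-adj i≢j Ni Nj))))
    N-K
  shape : ∀ {i j} → Around v i → Around v j → adj G i j ≡ not (i == j) ∧ (insertAt N v true i ∧ insertAt N v true j)
  shape here here rewrite ==-refl v = Graph.irrefl G v
  shape here (there y)
    rewrite insertAt-lookup N v true | insertAt-punchIn N v true y | ≢⇒==false (punchInᵢ≢i v y ∘ sym) = refl
  shape (there x) here
    rewrite insertAt-lookup N v true | insertAt-punchIn N v true x | ≢⇒==false (punchInᵢ≢i v x) =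
    trans (Graph.sym G (punchIn v x) v) (sym (∧-identityʳ (N x)))
  shape (there x) (there y)
    rewrite insertAt-punchIn N v true x | insertAt-punchIn N v true y = bool-ext
      (λ a → let x≢y , Kx , Ky = cliqueOn⁻ {G = remove G v} {K} K-clique a
                 l = two-elements K Kx Ky x≢y
             in and-true (cong not (≢⇒==false (x≢y ∘ Finₚ.punchIn-injective v x y))) (and-true (K⊆N l x Kx) (K⊆N l y Ky)))
      (λ h → let p , q = ∧-true {not (punchIn v x == punchIn v y)} h
                 Nx , Ny = ∧-true q
             in N-adj (λ { refl → contradiction (trans (sym (not-true⁻ p)) (==-refl (punchIn v x))) λ () }) Nx Ny)

toℕ-punchIn-last : ∀ {n} (i : Fin n) → toℕ (punchIn (Fin.fromℕ n) i) ≡ toℕ i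
toℕ-punchIn-last zero    = refl
toℕ-punchIn-last (suc i) = cong suc (toℕ-punchIn-last i)

sum-⟦⟧≤ : ∀ {n} (b : Fin n → Bool) → sum (⟦_⟧ ∘ b) ≤ n
sum-⟦⟧≤ {zero}  b = z≤n
sum-⟦⟧≤ {suc n} b with b zero
... | true  = s≤s (sum-⟦⟧≤ (b ∘ suc))
... | false = m≤n⇒m≤1+n (sum-⟦⟧≤ (b ∘ suc))

-- A vertex in Q is put in front of the others already sorted, a vertex outside Q behind them.
sorting-permutation : ∀ {n} (Q : Fin n → Bool) →
  ∃ λ (π : Permutation′ n) → ∀ i → (toℕ (π ⟨$⟩ʳ i) <ᵇ sum (⟦_⟧ ∘ Q)) ≡ Q i
sorting-permutation {zero}  Q = Perm.id , λ ()
sorting-permutation {suc n} Q with sorting-permutation (Q ∘ suc)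
... | π , h with Q zero in Q0
... | true  = Perm.lift₀ π , λ { zero → sym Q0 ; (suc i) → h i }
... | false = Perm.insert zero (Fin.fromℕ n) π , λ
  { zero    → trans (<ᵇ-false (subst (sum (⟦_⟧ ∘ Q ∘ suc) ≤_) (sym (Finₚ.toℕ-fromℕ n)) (sum-⟦⟧≤ (Q ∘ suc)))) (sym Q0)
  ; (suc i) → trans (cong (_<ᵇ sum (⟦_⟧ ∘ Q ∘ suc))
                (trans (cong toℕ (Perm.insert-punchIn zero (Fin.fromℕ n) π i)) (toℕ-punchIn-last (π ⟨$⟩ʳ i)))) (h i) }

cliqueOn⇒≅ : ∀ {n} {G : Graph n} {K} → CliqueOn G K → G ≅ KUnionE n (sum (⟦_⟧ ∘ K))
cliqueOn⇒≅ {n} {G} {K} h with sorting-permutation K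
... | π , sorted = π , λ i j → trans
  (cong₂ (λ a b → not a ∧ b)
    (≡ᵇ-cong (cong toℕ ∘ permutation-injective π {i} {j} ∘ toℕ-injective) (cong (toℕ ∘ (π ⟨$⟩ʳ_)) ∘ toℕ-injective))
    (cong₂ _∧_ (sorted i) (sorted j)))
  (sym (h i j))

insert-self : ∀ {n} (i j : Fin (suc n)) (π : Permutation′ n) → Perm.insert i j π ⟨$⟩ʳ i ≡ j
insert-self i j π with i Finₚ.≟ i
... | yes _   = refl
... | no  i≢i = contradiction refl i≢i

starAt⇒≅ : ∀ {n} {G : Graph (suc n)} u → (∀ i j → adj G i j ≡ true → i ≡ u ⊎ j ≡ u) →
  G ≅ StarUnionE (suc n) (degree G u)
starAt⇒≅ {n} {G} u h with sorting-permutation (nbr G u)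
... | π′ , sorted = π , λ i j → shape (around u i) (around u j)
  where
  π = Perm.insert u zero π′
  π-u : π ⟨$⟩ʳ u ≡ zero
  π-u = insert-self u zero π′
  π-there : ∀ x → π ⟨$⟩ʳ punchIn u x ≡ suc (π′ ⟨$⟩ʳ x)
  π-there = Perm.insert-punchIn u zero π′
  H = StarUnionE (suc n) (degree G u)
  leaf : ∀ x → (toℕ (π′ ⟨$⟩ʳ x) <ᵇ degree G u) ≡ nbr G u x
  leaf x = trans (cong (toℕ (π′ ⟨$⟩ʳ x) <ᵇ_) (degree-nbr G u)) (sorted x)
  shape : ∀ {i j} → Around u i → Around u j → adj H (π ⟨$⟩ʳ i) (π ⟨$⟩ʳ j) ≡ adj G i j
  shape here here = trans (cong₂ (adj H) π-u π-u) (sym (Graph.irrefl G u))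
  shape here (there y) = trans (cong₂ (adj H) π-u (π-there y)) (trans (∨-identityʳ _) (leaf y))
  shape (there x) here = trans (cong₂ (adj H) (π-there x) π-u)
    (trans (leaf x) (Graph.sym G u (punchIn u x)))
  shape (there x) (there y) = trans (cong₂ (adj H) (π-there x) (π-there y))
    (sym (≢true⇒false λ a → case h _ _ a of λ { (inj₁ p) → punchInᵢ≢i u x p ; (inj₂ p) → punchInᵢ≢i u y p }))

-- The three bounds

-- Any actual lowering makes the inequality strict, so equal averages force equal lists, and in that
-- case `iso` supplies the isomorphism.
average-bound : ∀ {n} {G H : Graph (suc n)} {L L′} → Elim G L → Realizes H L′ → 0 ⊢ L ≽ L′ →
  (L ≡ L′ → G ≅ H) → (G A≥ H) × ((G A≡ H) ⇔ (G ≅ H))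
average-bound {G = G} {H} {L} {L′} e r c iso with average-compare (elim-realizes e) r c
... | inj₁ (L≡L′ , eq) = ≤-reflexive (sym eq) , mk⇔ (λ _ → iso L≡L′) (iso-A≡ {G = G} {H})
... | inj₂ lt          = <⇒≤ lt , mk⇔ (λ eq → contradiction lt (<-irrefl (sym eq))) (iso-A≡ {G = G} {H})

clique-bound : ∀ {n} {G : Graph (suc n)} {L} → Elim G L →
  let H = KUnionE (suc n) (colors 0 L) in (G A≥ H) × ((G A≡ H) ⇔ (G ≅ H))
clique-bound {n} {G} {L} e = average-bound {H = KUnionE (suc n) (colors 0 L)} e
  (realizes (cliqueList-valid va) (trans (sym (≽-length dominated)) (elim-length e))
    λ k → trans (P-KUnionE (suc n) (colors 0 L) (repeats 0 L) k (trans (repeats+colors va) (elim-length e)))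
                (trans (sym (cliqueList-product k va)) (*-identityˡ _)))
  dominated iso
  where
  va = elim-valid e
  dominated = ≽-cliqueList va
  iso : L ≡ cliqueList 0 L → G ≅ KUnionE (suc n) (colors 0 L)
  iso eq = let K , size , h = clique-shape e (sym eq)
           in subst (λ c → G ≅ KUnionE (suc n) c) size (cliqueOn⇒≅ {G = G} {K} h)

-- `L ≡ starList q L` gives only zeros and ones, with q ones; `center` then makes u a vertex of
-- degree q, as `star-shape` requires. It serves for q = Δ with u of maximum degree, and for q = 0.
star-bound : ∀ {n} {G : Graph (suc n)} {L} → Elim G L → ∀ q u → q ≤ nonzeros L → (q ≡ nonzeros L → degree G u ≡ q) →
  let H = StarUnionE (suc n) q in (G A≥ H) × ((G A≡ H) ⇔ (G ≅ H))
star-bound {n} {G} {L} e q u q≤ center = go L e (elim-valid e) (elim-length e) q≤ center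
  where
  go : ∀ L → Elim G L → Valid 0 L → length L ≡ suc n → q ≤ nonzeros L → (q ≡ nonzeros L → degree G u ≡ q) →
    let H = StarUnionE (suc n) q in (G A≥ H) × ((G A≡ H) ⇔ (G ≅ H))
  -- Validity from 0 forces the first entry to be 0. After it one color is present, which makes the
  -- ones of `starList` admissible.
  go (zero ∷ L) e (_ ∷ va) len q≤ center = average-bound {H = StarUnionE (suc n) q} e
    (realizes (z≤n ∷ starList-valid ≤-refl q L) (trans (cong suc (sym (≽-length dominated))) len)
      λ k → trans (P-StarUnionE n (starZeros q L) q k (trans (starZeros+q q L q≤) (suc-injective len)))
                  (sym (starList-product k q (zero ∷ L) q≤)))
    (keep z≤n dominated) iso
    where
    dominated = ≽-starList ≤-refl q va
    iso : zero ∷ L ≡ zero ∷ starList q L → G ≅ StarUnionE (suc n) q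
    iso eq = subst (λ d → G ≅ StarUnionE (suc n) d) deg (starAt⇒≅ {G = G} u
      (star-shape e (subst (All (_≤ 1)) (sym eq) (starList-≤1 q (zero ∷ L))) u (trans deg q≡)))
      where
      q≡ : q ≡ nonzeros (zero ∷ L)
      q≡ = trans (sym (starList-nonzeros q (zero ∷ L) q≤)) (cong nonzeros (sym eq))
      deg : degree G u ≡ q
      deg = center q≡

star-empty : ∀ n → StarUnionE n 0 ≅ Empty n
star-empty n = ≗⇒≅ (StarUnionE n 0) (Empty n) λ i j → sym (no-edge i j)
  where
  e : ∀ x → ((1 ≤ᵇ x) ∧ (x ≤ᵇ 0)) ≡ false
  e zero    = refl
  e (suc x) = refl
  no-edge : ∀ i j → adj (StarUnionE n 0) i j ≡ false
  no-edge i j rewrite e (toℕ j) | e (toℕ i) | ∧-zeroʳ (toℕ i ≡ᵇ 0) | ∧-zeroʳ (toℕ j ≡ᵇ 0) = refl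

≅-via-≗ : ∀ {n} {G H H′ : Graph n} → (∀ i j → adj H i j ≡ adj H′ i j) → G ≅ H → G ≅ H′
≅-via-≗ h (π , p) = π , λ i j → trans (sym (h _ _)) (p i j)

theorem18 : ∀ {n : ℕ} (G : Graph n) → 1 ≤ n → Triangulated G →
    ∀ (χ Δ : ℕ) → IsChromaticNumber G χ → IsMaxDegree G Δ →
    ((G A≥ KUnionE n χ) × ((G A≡ KUnionE n χ) ⇔ (G ≅ KUnionE n χ)))
    × ((G A≥ StarUnionE n Δ) × ((G A≡ StarUnionE n Δ) ⇔ (G ≅ StarUnionE n Δ)))
    × ((G A≥ Empty n) × ((G A≡ Empty n) ⇔ (G ≅ Empty n)))
theorem18 {suc n} G _ tri χ Δ isχ ((u , deg-u) , _) with triangulated⇒elim G tri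
... | L , e rewrite elim-chromatic e χ isχ =
  clique-bound e ,
  star-bound e Δ u (subst (_≤ nonzeros L) deg-u (degree≤nonzeros e u)) (λ _ → deg-u) ,
  empty-bound
  where
  -- The empty graph is the star without leaves; moments and isomorphisms are carried over from one
  -- presentation to the other.
  H = StarUnionE (suc n) 0
  bound = star-bound e 0 u z≤n (λ q → n≤0⇒n≡0 (subst (degree G u ≤_) (sym q) (degree≤nonzeros e u)))
  same-𝓣 : 𝓣 H ≡ 𝓣 (Empty (suc n))
  same-𝓣 = iso-𝓣 {G = H} {Empty (suc n)} (star-empty (suc n))
  same-𝓑 : 𝓑 H ≡ 𝓑 (Empty (suc n))
  same-𝓑 = iso-𝓑 {G = H} {Empty (suc n)} (star-empty (suc n))
  edges : ∀ i j → adj H i j ≡ adj (Empty (suc n)) i j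
  edges i j = sym (proj₂ (star-empty (suc n)) i j)
  empty-bound : (G A≥ Empty (suc n)) × ((G A≡ Empty (suc n)) ⇔ (G ≅ Empty (suc n)))
  empty-bound =
    subst₂ (λ t b → t * 𝓑 G ≤ 𝓣 G * b) same-𝓣 same-𝓑 (proj₁ bound) ,
    mk⇔ (λ eq → ≅-via-≗ {G = G} {H} {Empty (suc n)} edges (Equivalence.to (proj₂ bound)
          (subst₂ (λ t b → 𝓣 G * b ≡ t * 𝓑 G) (sym same-𝓣) (sym same-𝓑) eq)))
        (iso-A≡ {G = G} {Empty (suc n)})
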